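{- Let $d\ge2$ be fixed, $c_0$ a constant (e.g. $c_0=100d$), and $c,c_1>0$ fixed constants. Define $R^2=2\log n+\log((\log n)^{c_0})$, $\rho^2=2\log n-\log\log n+\log\big((c\log\log n)^{ -2}\big)$, and $r=\rho-5c_1^2/\rho$. Let $y_1,\dots,y_m$ be a system of points on the sphere $S(\rho)$ of radius $\rho$ about the origin that is maximal with respect to the property $|y_i-y_j|\ge2c_1$ for $i\ne j$. Let $V_i=\{x:\ |x-y_i|\le|x-y_j|\text{ for all }j\}$ be the Voronoi region of $y_i$, let $A(R,r)=B(R)\setminus B(r)$, and let $W_i=V_i\cap A(R,r)$. Define the graph $G$ on vertex set $\{1,\dots,m\}$ in which $i\neq j$ are adjacent if and only if there exist $a_i\in W_i$, $a_j\in W_j$ and $b\in A(R,r)$ such that the segments $[a_i,b]$ and $[b,a_j]$ lie entirely in $A(R,r)$. Then the maximal degree $D$ of $G$ satisfies $D=O\big((\log\log n)^{\frac{d-1}{2}}\big)$ as $n\to\infty$.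
   Context: $B(x)$ denotes the closed ball of radius $x$ centered at the origin. $f(n)=O(g(n))$ means $f(n)\le Cg(n)$ for a constant $C$ independent of $n$ and all large $n$. -}

module Defs where

open import Algebra.Bundles using (CommutativeRing; Semiring)
open import Algebra.Structures using (IsCommutativeRing)
open import Axiom.ExcludedMiddle using (ExcludedMiddle)
open import Data.Fin.Base using (Fin)
open import Data.List.Base using (allFin; filter; length)
open import Data.Nat.Base as ℕ using (ℕ; suc)
open import Data.Product.Base using (∃; ∃-syntax; _×_; _,_)
open import Data.Vec.Functional using (Vector; foldr)
open import Level using (0ℓ)
open import Relation.Binary.Core using (Rel)
import Relation.Binary.Construct.NonStrictToStrict as Strict
open import Relation.Binary.PropositionalEquality.Core using (_≢_)
open import Relation.Binary.Structures using (IsTotalOrder)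
open import Relation.Nullary using (¬_; yes; no)
open import Relation.Unary using (Pred; _⊆_; _∩_; _∖_)

-- The standard library has no real numbers.  ℝ is given by its usual
-- axioms, which determine it up to isomorphism in the presence of
-- excluded middle.  The value of 0# ⁻¹ is left unconstrained.
record CompleteOrderedField : Set₁ where
  infix  8 _⁻¹
  infix  8 -_
  infixl 7 _*_
  infixl 6 _+_
  infix  4 _≈_ _≤_
  field
    Carrier : Set
    _≈_ _≤_ : Rel Carrier 0ℓ
    _+_ _*_ : Carrier → Carrier → Carrier
    -_ _⁻¹  : Carrier → Carrier
    0# 1#   : Carrier

    isCommutativeRing : IsCommutativeRing _≈_ _+_ _*_ -_ 0# 1#
    1≉0               : ¬ (1# ≈ 0#)
    ⁻¹-inverseʳ       : ∀ x → ¬ (x ≈ 0#) → x * x ⁻¹ ≈ 1#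

    isTotalOrder      : IsTotalOrder _≈_ _≤_
    +-monoʳ-≤         : ∀ z {x y} → x ≤ y → z + x ≤ z + y
    *-nonNeg          : ∀ {x y} → 0# ≤ x → 0# ≤ y → 0# ≤ x * y

  UpperBound : Pred Carrier 0ℓ → Pred Carrier 0ℓ
  UpperBound P b = ∀ x → P x → x ≤ b

  IsSupremum : Pred Carrier 0ℓ → Pred Carrier 0ℓ
  IsSupremum P s = UpperBound P s × (∀ b → UpperBound P b → s ≤ b)

  field
    complete : ∀ (P : Pred Carrier 0ℓ) → ∃ P → ∃ (UpperBound P) → ∃ (IsSupremum P)

  commutativeRing : CommutativeRing 0ℓ 0ℓ
  commutativeRing = record { isCommutativeRing = isCommutativeRing }

  open CommutativeRing commutativeRing public using (_-_; semiring)
  open Strict _≈_ _≤_ public using (_<_)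
  open import Algebra.Definitions.RawSemiring (Semiring.rawSemiring semiring) public
    using (sum; _^_) renaming (_×_ to _·_)

  infixl 7 _/_
  _/_ : Carrier → Carrier → Carrier
  x / y = x * y ⁻¹

  fromℕ : ℕ → Carrier
  fromℕ n = n · 1#


module Analysis (em : ExcludedMiddle 0ℓ) (ℝ : CompleteOrderedField) where

  open CompleteOrderedField ℝ

  -- The functions below are total: `some P` is 0# when nothing satisfies P.
  -- Each is applied to a P that has at most one solution up to ≈.
  some : Pred Carrier 0ℓ → Carrier
  some P with em {∃ P}
  ... | yes (x , _) = x
  ... | no  _       = 0#

  ConvergesTo : (ℕ → Carrier) → Pred Carrier 0ℓ
  ConvergesTo a l = ∀ ε → 0# < ε →
    ∃[ N ] (∀ n → N ℕ.≤ n → l - ε < a n × a n < l + ε)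

  lim : (ℕ → Carrier) → Carrier
  lim a = some (ConvergesTo a)

  sqrt : Carrier → Carrier
  sqrt x = some (λ y → 0# ≤ y × y * y ≈ x)

  -- Euler's limit (1 + x/k)ᵏ, with k = suc n to avoid division by zero.
  exp : Carrier → Carrier
  exp x = lim (λ n → (1# + x / fromℕ (suc n)) ^ suc n)

  log : Carrier → Carrier
  log x = some (λ y → exp y ≈ x)

  -- Real powers; meaningful for positive base.
  infixr 8 _**_
  _**_ : Carrier → Carrier → Carrier
  x ** a = exp (a * log x)


module Geometry (em : ExcludedMiddle 0ℓ) (ℝ : CompleteOrderedField) (d : ℕ) where

  open CompleteOrderedField ℝ
  open Analysis em ℝ

  Point : Set
  Point = Vector Carrier d

  infix 4 _≋_
  _≋_ : Rel Point 0ℓ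
  x ≋ y = ∀ k → x k ≈ y k

  norm : Point → Carrier
  norm x = sqrt (sum (λ k → x k * x k))

  dist : Point → Point → Carrier
  dist x y = norm (λ k → x k - y k)

  Ball : Carrier → Pred Point 0ℓ
  Ball s x = norm x ≤ s

  Sphere : Carrier → Pred Point 0ℓ
  Sphere s x = norm x ≈ s

  Annulus : Carrier → Carrier → Pred Point 0ℓ
  Annulus R r = Ball R ∖ Ball r

  Segment : Point → Point → Pred Point 0ℓ
  Segment a b z = ∃[ t ] (0# ≤ t × t ≤ 1# × z ≋ (λ k → (1# - t) * a k + t * b k))

  Points : ∀ {m} → Vector Point m → Pred Point 0ℓ
  Points y x = ∃[ i ] x ≋ y i

  IsSeparatedSystem : Carrier → Carrier → ∀ {m} → Vector Point m → Set
  IsSeparatedSystem ρ δ y =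
    (∀ i → Sphere ρ (y i)) × (∀ i j → i ≢ j → δ ≤ dist (y i) (y j))

  -- Maximality is with respect to inclusion of the underlying point sets.
  IsMaximalSystem : Carrier → Carrier → ∀ {m} → Vector Point m → Set
  IsMaximalSystem ρ δ y =
    IsSeparatedSystem ρ δ y ×
    (∀ k (z : Vector Point k) → IsSeparatedSystem ρ δ z →
       Points y ⊆ Points z → Points z ⊆ Points y)

  Voronoi : ∀ {m} → Vector Point m → Fin m → Pred Point 0ℓ
  Voronoi y i x = ∀ j → dist x (y i) ≤ dist x (y j)

  Cell : Carrier → Carrier → ∀ {m} → Vector Point m → Fin m → Pred Point 0ℓ
  Cell R r y i = Voronoi y i ∩ Annulus R r

  Adjacent : Carrier → Carrier → ∀ {m} → Vector Point m → Rel (Fin m) 0ℓ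
  Adjacent R r y i j = i ≢ j ×
    (∃[ aᵢ ] ∃[ aⱼ ] ∃[ b ]
       (Cell R r y i aᵢ × Cell R r y j aⱼ × Annulus R r b ×
        Segment aᵢ b ⊆ Annulus R r × Segment b aⱼ ⊆ Annulus R r))

  degree : Carrier → Carrier → ∀ {m} → Vector Point m → Fin m → ℕ
  degree R r {m} y i = length (filter (λ j → em {Adjacent R r y i j}) (allFin m))

  maxDegree : Carrier → Carrier → ∀ {m} → Vector Point m → ℕ
  maxDegree R r y = foldr ℕ._⊔_ 0 (degree R r y)


module Radii (em : ExcludedMiddle 0ℓ) (ℝ : CompleteOrderedField) where

  open CompleteOrderedField ℝ
  open Analysis em ℝ

  logℕ : ℕ → Carrier
  logℕ n = log (fromℕ n)

  loglogℕ : ℕ → Carrier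
  loglogℕ n = log (logℕ n)

  outerRadius : (c₀ : Carrier) → ℕ → Carrier
  outerRadius c₀ n = sqrt (fromℕ 2 * logℕ n + log (logℕ n ** c₀))

  sphereRadius : (c : Carrier) → ℕ → Carrier
  sphereRadius c n =
    sqrt (fromℕ 2 * logℕ n - loglogℕ n + log (((c * loglogℕ n) ^ 2) ⁻¹))

  innerRadius : (c c₁ : Carrier) → ℕ → Carrier
  innerRadius c c₁ n = sphereRadius c n - fromℕ 5 * c₁ ^ 2 / sphereRadius c n

module Submission where

-- Everything is measured in squared distances, where |u + v|² ≤ 2|u|² + 2|v|² replaces the triangle
-- inequality.  Write ℓ = log log n.  Then R² − ρ² = O(ℓ) and ρ² − r² = O(1), so by the parallelogram
-- law a segment whose ends lie in B(R) and whose midpoint avoids B(r) has squared length at most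
-- 4(R² − r²) = O(ℓ).  By maximality the radial projection of a point of a cell W_i to S(ρ) is within 2c₁
-- of the system, which gives |a − y_i|² = O(ℓ) for a ∈ W_i.  Hence all neighbours y_j of y_i in G satisfy
-- |y_i − y_j| ≤ T with T = O(√ℓ), whereas ρ² dominates every multiple of ℓ.
--
-- To count them with exponent d − 1, pick a coordinate k with |y_i(k)| ≥ ρ/d.  Near y_i the sphere is a
-- Lipschitz graph over the other d − 1 coordinates, since the u(k)² + Σ_{l≠k} u(l)² are all equal and
-- |u(k) + v(k)| ≥ ρ/d.  So neighbours in the same cell of a grid of mesh s on these coordinates, s a small
-- multiple of c₁, would be closer than 2c₁; there are (O(T/s))^(d−1) grid cells.
--
-- The exponential is E(x) = sup_k (1 + x/k)^k.  Its functional equation needs no limits of products: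
-- (1 + x/k)(1 + y/k) ≤ (1 + (x + y)/2k)² gives E(x)E(y) ≤ E(x + y), and Bernoulli's inequality
-- gives E(x)E(−x) ≥ 1.

open import Defs
open import Algebra.Bundles using (CommutativeRing)
import Algebra.Properties.Ring as RingProperties
import Algebra.Properties.Semiring.Exp as Exp
import Algebra.Properties.Semiring.Mult as Mult
import Algebra.Properties.Semiring.Sum as Sum
import Algebra.Solver.Ring as RingSolver
open import Algebra.Solver.Ring.AlmostCommutativeRing using (fromCommutativeRing; _-Raw-AlmostCommutative⟶_)
open import Axiom.ExcludedMiddle using (ExcludedMiddle)
import Data.Bool.Base as Bool
open import Data.Empty using (⊥-elim)
open import Data.Fin.Base using (Fin; zero; suc; punchIn; punchOut; funToFin; finToFun)
import Data.Fin.Properties as Fin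
open import Data.Integer.Base as ℤ using (ℤ; +_; -[1+_]; _⊖_; _◃_)
import Data.Integer.Properties as ℤ
open import Data.List.Base using (List; length; lookup; filter; allFin)
open import Data.List.Membership.Propositional.Properties using (∈-lookup)
open import Data.List.Relation.Unary.All as All using (All)
open import Data.List.Relation.Unary.All.Properties using (all-filter)
open import Data.List.Relation.Unary.AllPairs using (_∷_)
open import Data.List.Relation.Unary.Unique.Propositional using (Unique)
open import Data.List.Relation.Unary.Unique.Propositional.Properties using (allFin⁺; filter⁺)
open import Data.Maybe using (Maybe; just; nothing; is-just; to-witness-T)
open import Data.Nat.Base as ℕ using (ℕ; zero; suc)
import Data.Nat.Properties as ℕ
open import Data.Product.Base using (∃; ∃-syntax; _×_; _,_; proj₁; proj₂)
open import Data.Sign.Base as Sign using (Sign)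
open import Data.Sum.Base using (inj₁; inj₂)
open import Data.Vec.Functional as Vector using (Vector)
open import Data.Vec.N-ary using (N-ary; Eq; curryⁿ; curryⁿ-cong)
open import Function.Base using (_$_; case_of_; _∘_)
open import Level using (0ℓ)
import Relation.Binary.PropositionalEquality as ≡
open import Relation.Binary.Structures using (IsTotalOrder)
open import Relation.Nullary using (¬_; yes; no)
open import Relation.Unary using (Pred; Decidable; _⊆_)
open ≡ using (_≡_; _≢_)

-- Ordered field arithmetic, a ring solver and the Archimedean property.

module OrderedField (em : ExcludedMiddle 0ℓ) (ℝ : CompleteOrderedField) where

  open CompleteOrderedField ℝ
  open CommutativeRing commutativeRing public
    using (refl; sym; trans; reflexive; setoid; ring;
           +-cong; +-congˡ; +-congʳ; *-cong; *-congˡ; *-congʳ; -‿cong;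
           +-identityˡ; +-identityʳ; *-identityˡ; *-identityʳ; zeroˡ;
           +-comm; +-assoc; -‿inverseʳ; -‿inverseˡ; *-comm)
  open RingProperties ring using (-‿distribˡ-*; -‿distribʳ-*; -0#≈0#; -‿involutive; -‿+-comm)
  open Mult semiring using (×-homo-+; ×1-homo-*)
  open import Relation.Binary.Reasoning.Setoid setoid

  ⟦_⟧ℤ : ℤ → Carrier
  ⟦ + n      ⟧ℤ = fromℕ n
  ⟦ -[1+ n ] ⟧ℤ = - fromℕ (suc n)

  ⊖-homo : ∀ m n → ⟦ m ⊖ n ⟧ℤ ≈ fromℕ m - fromℕ n
  ⊖-homo m       zero    = sym (trans (+-congˡ -0#≈0#) (+-identityʳ _))
  ⊖-homo zero    (suc n) = sym (+-identityˡ _)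
  ⊖-homo (suc m) (suc n) = begin
    ⟦ suc m ⊖ suc n ⟧ℤ                       ≡⟨ ≡.cong ⟦_⟧ℤ (ℤ.[1+m]⊖[1+n]≡m⊖n m n) ⟩
    ⟦ m ⊖ n ⟧ℤ                               ≈⟨ ⊖-homo m n ⟩
    fromℕ m - fromℕ n                        ≈⟨ +-congʳ (+-identityˡ _) ⟨
    0# + fromℕ m - fromℕ n                   ≈⟨ +-congʳ (+-congʳ (-‿inverseʳ 1#)) ⟨
    1# - 1# + fromℕ m - fromℕ n              ≈⟨ +-congʳ (trans (+-assoc _ _ _) (trans (+-congˡ (+-comm _ _)) (sym (+-assoc _ _ _)))) ⟩
    fromℕ (suc m) - 1# - fromℕ n             ≈⟨ trans (+-assoc _ _ _) (+-congˡ (-‿+-comm 1# (fromℕ n))) ⟩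
    fromℕ (suc m) - fromℕ (suc n)            ∎

  ℤ-homo-+ : ∀ i j → ⟦ i ℤ.+ j ⟧ℤ ≈ ⟦ i ⟧ℤ + ⟦ j ⟧ℤ
  ℤ-homo-+ (+ m)      (+ n)      = ×-homo-+ 1# m n
  ℤ-homo-+ (+ m)      -[1+ n ]   = ⊖-homo m (suc n)
  ℤ-homo-+ -[1+ m ]   (+ n)      = trans (⊖-homo n (suc m)) (+-comm _ _)
  ℤ-homo-+ -[1+ m ]   -[1+ n ]   = begin
    - fromℕ (suc (suc (m ℕ.+ n)))             ≡⟨ ≡.cong (λ k → - fromℕ k) (≡.sym (ℕ.+-suc (suc m) n)) ⟩
    - fromℕ (suc m ℕ.+ suc n)                 ≈⟨ -‿cong (×-homo-+ 1# (suc m) (suc n)) ⟩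
    - (fromℕ (suc m) + fromℕ (suc n))         ≈⟨ -‿+-comm _ _ ⟨
    - fromℕ (suc m) - fromℕ (suc n)           ∎

  ◃-pos : ∀ n → ⟦ Sign.+ ◃ n ⟧ℤ ≈ fromℕ n
  ◃-pos zero    = refl
  ◃-pos (suc n) = refl

  ◃-neg : ∀ n → ⟦ Sign.- ◃ n ⟧ℤ ≈ - fromℕ n
  ◃-neg zero    = sym -0#≈0#
  ◃-neg (suc n) = refl

  ℤ-homo-* : ∀ i j → ⟦ i ℤ.* j ⟧ℤ ≈ ⟦ i ⟧ℤ * ⟦ j ⟧ℤ
  ℤ-homo-* (+ m)      (+ n)      = trans (◃-pos (m ℕ.* n)) (×1-homo-* m n)
  ℤ-homo-* (+ m)      -[1+ n ]   = trans (◃-neg (m ℕ.* suc n)) (trans (-‿cong (×1-homo-* m (suc n))) (-‿distribʳ-* _ _))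
  ℤ-homo-* -[1+ m ]   (+ n)      = trans (◃-neg (suc m ℕ.* n)) (trans (-‿cong (×1-homo-* (suc m) n)) (-‿distribˡ-* _ _))
  ℤ-homo-* -[1+ m ]   -[1+ n ]   = begin
    fromℕ (suc m ℕ.* suc n)                   ≈⟨ ×1-homo-* (suc m) (suc n) ⟩
    fromℕ (suc m) * fromℕ (suc n)             ≈⟨ -‿involutive _ ⟨
    - (- (fromℕ (suc m) * fromℕ (suc n)))     ≈⟨ -‿cong (-‿distribˡ-* _ _) ⟩
    - (- fromℕ (suc m) * fromℕ (suc n))       ≈⟨ -‿distribʳ-* _ _ ⟩
    - fromℕ (suc m) * - fromℕ (suc n)         ∎

  ℤ-homo-neg : ∀ i → ⟦ ℤ.- i ⟧ℤ ≈ - ⟦ i ⟧ℤ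
  ℤ-homo-neg (+ zero)   = sym -0#≈0#
  ℤ-homo-neg (+ suc n)  = refl
  ℤ-homo-neg -[1+ n ]   = sym (-‿involutive _)

  -- Integer coefficients have decidable equality, so normal forms can be compared by computation;
  -- elements of the abstract field do not allow this.
  ℤ-morphism : ℤ.+-*-rawRing -Raw-AlmostCommutative⟶ fromCommutativeRing commutativeRing
  ℤ-morphism = record
    { ⟦_⟧    = ⟦_⟧ℤ
    ; +-homo = ℤ-homo-+
    ; *-homo = ℤ-homo-*
    ; -‿homo = ℤ-homo-neg
    ; 0-homo = refl
    ; 1-homo = +-identityʳ 1#
    }

  ℤ-coeff≟ : ∀ i j → Maybe (⟦ i ⟧ℤ ≈ ⟦ j ⟧ℤ)
  ℤ-coeff≟ i j with i ℤ.≟ j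
  ... | yes i≡j = just (reflexive (≡.cong ⟦_⟧ℤ i≡j))
  ... | no  _   = nothing

  open RingSolver ℤ.+-*-rawRing (fromCommutativeRing commutativeRing) ℤ-morphism ℤ-coeff≟ public
    using (Polynomial; _:+_; _:*_; _:-_; :-_; _:^_; _:=_)
  module Solver = RingSolver ℤ.+-*-rawRing (fromCommutativeRing commutativeRing) ℤ-morphism ℤ-coeff≟
  open import Relation.Binary.Reflection setoid Solver.var Solver.⟦_⟧ Solver.⟦_⟧↓ Solver.correct using (close; prove)

  infix 9 #_
  #_ : ∀ {n} → ℕ → Polynomial n
  # k = Solver.con (+ k)

  -- # 1 denotes 1# + 0#, which is not 1# on the nose.
  :1 : ∀ {n} → Polynomial n
  :1 = (# 0) :^ 0

  -- Comparing normal forms, rather than their values in ℝ, keeps the check a closed computation.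
  solve : ∀ n (f : N-ary n (Polynomial n) (Polynomial n × Polynomial n)) →
          let p = proj₁ (close n f) ; q = proj₂ (close n f) in
          {Bool.T (is-just (Solver.normalise p Solver.≟N Solver.normalise q))} →
          Eq n _≈_ (curryⁿ (Solver.⟦_⟧ p)) (curryⁿ (Solver.⟦_⟧ q))
  solve n f {p≟q} = curryⁿ-cong _≈_ (Solver.⟦_⟧ p) (Solver.⟦_⟧ q)
    λ ρ → prove ρ p q (Solver.⟦ to-witness-T (Solver.normalise p Solver.≟N Solver.normalise q) p≟q ⟧N-cong ρ)
    where
    p q : Polynomial n
    p = proj₁ (close n f)
    q = proj₂ (close n f)

  private module ≤ = IsTotalOrder isTotalOrder
  open ≤ public using () renaming
    (refl to ≤-refl; reflexive to ≤-reflexive; trans to ≤-trans; antisym to ≤-antisym; total to ≤-total)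

  -- Most inequalities below are certified this way: e is built from evidently nonnegative terms,
  -- and the identity is left to the ring solver.
  ≤-by : ∀ {x y e} → 0# ≤ e → y ≈ x + e → x ≤ y
  ≤-by {x} {y} {e} 0≤e y≈x+e =
    ≤-trans (≤-reflexive (sym (+-identityʳ x))) (≤-trans (+-monoʳ-≤ x 0≤e) (≤-reflexive (sym y≈x+e)))

  ≤⇒0≤ : ∀ {x y} → x ≤ y → 0# ≤ y - x
  ≤⇒0≤ {x} {y} x≤y =
    ≤-trans (≤-reflexive (sym (-‿inverseˡ x))) (≤-trans (+-monoʳ-≤ (- x) x≤y) (≤-reflexive (+-comm (- x) y)))

  ≤-resp : ∀ {x x′ y y′} → x ≈ x′ → y ≈ y′ → x ≤ y → x′ ≤ y′
  ≤-resp p q x≤y = ≤-trans (≤-reflexive (sym p)) (≤-trans x≤y (≤-reflexive q))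

  +-nonNeg : ∀ {x y} → 0# ≤ x → 0# ≤ y → 0# ≤ x + y
  +-nonNeg {x} {y} 0≤x 0≤y = ≤-trans 0≤x (≤-by 0≤y refl)

  ≰⇒≥ : ∀ {x y} → ¬ (x ≤ y) → y ≤ x
  ≰⇒≥ {x} {y} x≰y with ≤-total x y
  ... | inj₁ x≤y = ⊥-elim (x≰y x≤y)
  ... | inj₂ y≤x = y≤x

  ≰⇒> : ∀ {x y} → ¬ (x ≤ y) → y < x
  ≰⇒> x≰y = ≰⇒≥ x≰y , λ y≈x → x≰y (≤-reflexive (sym y≈x))

  <⇒≤ : ∀ {x y} → x < y → x ≤ y
  <⇒≤ = proj₁

  <⇒≱ : ∀ {x y} → x < y → ¬ (y ≤ x)
  <⇒≱ (x≤y , x≉y) y≤x = x≉y (≤-antisym x≤y y≤x)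

  ≮⇒≥ : ∀ {x y} → ¬ (x < y) → y ≤ x
  ≮⇒≥ {x} {y} x≮y with ≤-total x y
  ... | inj₂ y≤x = y≤x
  ... | inj₁ x≤y with em {x ≈ y}
  ...   | yes x≈y = ≤-reflexive (sym x≈y)
  ...   | no  x≉y = ⊥-elim (x≮y (x≤y , x≉y))

  <-≤-trans : ∀ {x y z} → x < y → y ≤ z → x < z
  <-≤-trans x<y y≤z = ≰⇒> λ z≤x → <⇒≱ x<y (≤-trans y≤z z≤x)

  ≤-<-trans : ∀ {x y z} → x ≤ y → y < z → x < z
  ≤-<-trans x≤y y<z = ≰⇒> λ z≤x → <⇒≱ y<z (≤-trans z≤x x≤y)

  <-resp : ∀ {x x′ y y′} → x ≈ x′ → y ≈ y′ → x < y → x′ < y′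
  <-resp p q x<y = ≤-<-trans (≤-reflexive (sym p)) (<-≤-trans x<y (≤-reflexive q))

  <-by : ∀ {x y e} → 0# < e → y ≈ x + e → x < y
  <-by {x} {y} {e} 0<e y≈x+e = ≰⇒> λ y≤x → <⇒≱ 0<e
    (≤-by (≤⇒0≤ y≤x) (trans (solve 2 (λ x e → # 0 := e :+ (x :- (x :+ e))) x e)
                            (+-congˡ (+-congˡ (-‿cong (sym y≈x+e))))))

  <⇒0< : ∀ {x y} → x < y → 0# < y - x
  <⇒0< {x} {y} x<y = ≰⇒> λ y-x≤0 → <⇒≱ x<y
    (≤-by (≤⇒0≤ y-x≤0) (solve 2 (λ x y → x := y :+ (# 0 :- (y :- x))) x y))

  +-pos : ∀ {x y} → 0# < x → 0# ≤ y → 0# < x + y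
  +-pos 0<x 0≤y = <-≤-trans 0<x (≤-by 0≤y refl)

  x*x⁻¹≈1 : ∀ {x} → 0# < x → x * x ⁻¹ ≈ 1#
  x*x⁻¹≈1 {x} (_ , 0≉x) = ⁻¹-inverseʳ x (λ x≈0 → 0≉x (sym x≈0))

  *-pos : ∀ {x y} → 0# < x → 0# < y → 0# < x * y
  *-pos {x} {y} 0<x (0≤y , 0≉y) = *-nonNeg (<⇒≤ 0<x) 0≤y , λ 0≈xy → 0≉y $ begin
    0#                ≈⟨ zeroˡ (x ⁻¹) ⟨
    0# * x ⁻¹         ≈⟨ *-congʳ 0≈xy ⟩
    x * y * x ⁻¹      ≈⟨ solve 3 (λ x y x⁻¹ → x :* y :* x⁻¹ := y :* (x :* x⁻¹)) x y (x ⁻¹) ⟩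
    y * (x * x ⁻¹)    ≈⟨ *-congˡ (x*x⁻¹≈1 0<x) ⟩
    y * 1#            ≈⟨ *-identityʳ y ⟩
    y                 ∎

  0≤x² : ∀ x → 0# ≤ x * x
  0≤x² x with ≤-total 0# x
  ... | inj₁ 0≤x = *-nonNeg 0≤x 0≤x
  ... | inj₂ x≤0 = ≤-resp refl (solve 1 (λ x → (# 0 :- x) :* (# 0 :- x) := x :* x) x)
                     (*-nonNeg (≤⇒0≤ x≤0) (≤⇒0≤ x≤0))

  0<1 : 0# < 1#
  0<1 = ≤-resp refl (*-identityʳ 1#) (0≤x² 1#) , λ 0≈1 → 1≉0 (sym 0≈1)

  0≤fromℕ : ∀ n → 0# ≤ fromℕ n
  0≤fromℕ zero    = ≤-refl
  0≤fromℕ (suc n) = +-nonNeg (<⇒≤ 0<1) (0≤fromℕ n)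

  0<fromℕ : ∀ n → 0# < fromℕ (suc n)
  0<fromℕ n = +-pos 0<1 (0≤fromℕ n)

  fromℕ-mono : ∀ {m n} → m ℕ.≤ n → fromℕ m ≤ fromℕ n
  fromℕ-mono {n = n} ℕ.z≤n = 0≤fromℕ n
  fromℕ-mono (ℕ.s≤s m≤n)   = +-monoʳ-≤ 1# (fromℕ-mono m≤n)

  *-monoˡ-≤ : ∀ {x y} z → 0# ≤ z → x ≤ y → z * x ≤ z * y
  *-monoˡ-≤ {x} {y} z 0≤z x≤y =
    ≤-by (*-nonNeg 0≤z (≤⇒0≤ x≤y)) (solve 3 (λ x y z → z :* y := z :* x :+ z :* (y :- x)) x y z)

  *-monoˡ-< : ∀ {x y} z → 0# < z → x < y → z * x < z * y
  *-monoˡ-< {x} {y} z 0<z x<y =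
    <-by (*-pos 0<z (<⇒0< x<y)) (solve 3 (λ x y z → z :* y := z :* x :+ z :* (y :- x)) x y z)

  *-mono-≤ : ∀ {w x y z} → 0# ≤ w → 0# ≤ y → w ≤ x → y ≤ z → w * y ≤ x * z
  *-mono-≤ {w} {x} {y} {z} 0≤w 0≤y w≤x y≤z =
    ≤-by (+-nonNeg (*-nonNeg (≤⇒0≤ w≤x) (≤-trans 0≤y y≤z)) (*-nonNeg 0≤w (≤⇒0≤ y≤z)))
         (solve 4 (λ w x y z → x :* z := w :* y :+ ((x :- w) :* z :+ w :* (z :- y))) w x y z)

  +-mono-≤ : ∀ {w x y z} → w ≤ x → y ≤ z → w + y ≤ x + z
  +-mono-≤ {w} {x} {y} {z} w≤x y≤z =
    ≤-by (+-nonNeg (≤⇒0≤ w≤x) (≤⇒0≤ y≤z))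
         (solve 4 (λ w x y z → x :+ z := w :+ y :+ ((x :- w) :+ (z :- y))) w x y z)

  *-cancelˡ-≤ : ∀ {x y} z → 0# < z → z * x ≤ z * y → x ≤ y
  *-cancelˡ-≤ z 0<z zx≤zy = ≮⇒≥ λ y<x → <⇒≱ (*-monoˡ-< z 0<z y<x) zx≤zy

  *-pos⁻ : ∀ {x y} → 0# ≤ x → 0# < x * y → 0# < y
  *-pos⁻ {x} {y} 0≤x 0<xy = ≰⇒> λ y≤0 → <⇒≱ 0<xy
    (≤-by (*-nonNeg 0≤x (≤⇒0≤ y≤0)) (solve 2 (λ x y → # 0 := x :* y :+ x :* (# 0 :- y)) x y))

  0<x⁻¹ : ∀ {x} → 0# < x → 0# < x ⁻¹
  0<x⁻¹ 0<x = *-pos⁻ (<⇒≤ 0<x) (<-resp refl (sym (x*x⁻¹≈1 0<x)) 0<1)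

  0<x/y : ∀ {x y} → 0# < x → 0# < y → 0# < x / y
  0<x/y 0<x 0<y = *-pos 0<x (0<x⁻¹ 0<y)

  [x/y]*y≈x : ∀ x {y} → 0# < y → x / y * y ≈ x
  [x/y]*y≈x x {y} 0<y = begin
    x / y * y         ≈⟨ solve 3 (λ x y y⁻¹ → x :* y⁻¹ :* y := x :* (y :* y⁻¹)) x y (y ⁻¹) ⟩
    x * (y * y ⁻¹)    ≈⟨ *-congˡ (x*x⁻¹≈1 0<y) ⟩
    x * 1#            ≈⟨ *-identityʳ x ⟩
    x                 ∎

  *≤⇒≤/ : ∀ {x y z} → 0# < y → x * y ≤ z → x ≤ z / y
  *≤⇒≤/ {x} {y} {z} 0<y xy≤z = *-cancelˡ-≤ y 0<y
    (≤-resp (*-comm x y) (sym (trans (*-comm y _) ([x/y]*y≈x z 0<y))) xy≤z)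

  ≤/⇒*≤ : ∀ {x y z} → 0# < y → x ≤ z / y → x * y ≤ z
  ≤/⇒*≤ {x} {y} {z} 0<y x≤z/y =
    ≤-resp (*-comm y x) (trans (*-comm y _) ([x/y]*y≈x z 0<y)) (*-monoˡ-≤ y (<⇒≤ 0<y) x≤z/y)

  square-cancel-≤ : ∀ {x y} → 0# ≤ y → x * x ≤ y * y → x ≤ y
  square-cancel-≤ {x} {y} 0≤y x²≤y² = ≮⇒≥ λ y<x → <⇒≱
    (<-by (*-pos (<⇒0< y<x) (+-pos (<⇒0< y<x) (+-nonNeg 0≤y 0≤y)))
          (solve 2 (λ x y → x :* x := y :* y :+ (x :- y) :* ((x :- y) :+ (y :+ y))) x y))
    x²≤y²

  square-mono-≤ : ∀ {x y} → 0# ≤ x → x ≤ y → x * x ≤ y * y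
  square-mono-≤ 0≤x x≤y = *-mono-≤ 0≤x 0≤x x≤y x≤y

  square-cancel-≈ : ∀ {x y} → 0# ≤ x → 0# ≤ y → x * x ≈ y * y → x ≈ y
  square-cancel-≈ 0≤x 0≤y x²≈y² = ≤-antisym
    (square-cancel-≤ 0≤y (≤-reflexive x²≈y²)) (square-cancel-≤ 0≤x (≤-reflexive (sym x²≈y²)))

  ^-cong : ∀ {x y} n → x ≈ y → x ^ n ≈ y ^ n
  ^-cong zero    x≈y = refl
  ^-cong (suc n) x≈y = *-cong x≈y (^-cong n x≈y)

  ^-nonNeg : ∀ {x} n → 0# ≤ x → 0# ≤ x ^ n
  ^-nonNeg zero    0≤x = <⇒≤ 0<1
  ^-nonNeg (suc n) 0≤x = *-nonNeg 0≤x (^-nonNeg n 0≤x)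

  ^-pos : ∀ {x} n → 0# < x → 0# < x ^ n
  ^-pos zero    0<x = 0<1
  ^-pos (suc n) 0<x = *-pos 0<x (^-pos n 0<x)

  ^-mono-≤ : ∀ {x y} n → 0# ≤ x → x ≤ y → x ^ n ≤ y ^ n
  ^-mono-≤ zero    0≤x x≤y = ≤-refl
  ^-mono-≤ (suc n) 0≤x x≤y = *-mono-≤ 0≤x (^-nonNeg n 0≤x) x≤y (^-mono-≤ n 0≤x x≤y)

  ^-distrib-* : ∀ x y n → (x * y) ^ n ≈ x ^ n * y ^ n
  ^-distrib-* x y zero    = sym (*-identityʳ 1#)
  ^-distrib-* x y (suc n) = trans (*-congˡ (^-distrib-* x y n))
    (solve 4 (λ x y u v → x :* y :* (u :* v) := x :* u :* (y :* v)) x y (x ^ n) (y ^ n))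

  fromℕ-^ : ∀ m n → fromℕ (m ℕ.^ n) ≈ fromℕ m ^ n
  fromℕ-^ m zero    = +-identityʳ 1#
  fromℕ-^ m (suc n) = trans (×1-homo-* m (m ℕ.^ n)) (*-congˡ (fromℕ-^ m n))

  -- Otherwise s = sup ℕ exists, and s - 1# is a smaller upper bound.
  archimedean : ∀ x → ∃[ n ] x ≤ fromℕ n
  archimedean x with em {∃[ n ] x ≤ fromℕ n}
  ... | yes p = p
  ... | no ¬p = ⊥-elim $ case complete Naturals (0# , zero , refl) (x , bound) of λ where
      (s , s-ub , s-least) → <⇒≱ (<-by 0<1 (solve 1 (λ s → s := (s :- :1) :+ :1) s))
        (s-least (s - 1#) λ where
          y (n , y≈n) → ≤-by (≤⇒0≤ (s-ub (fromℕ (suc n)) (suc n , refl)))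
            (trans (solve 2 (λ s m → s :- :1 := m :+ (s :- (:1 :+ m))) s (fromℕ n))
                   (+-congʳ (sym y≈n))))
    where
    Naturals : Carrier → Set
    Naturals y = ∃[ n ] y ≈ fromℕ n
    bound : UpperBound Naturals x
    bound y (n , y≈n) = ≤-trans (≤-reflexive y≈n) (≰⇒≥ λ x≤n → ¬p (n , x≤n))

  -- Descent from an Archimedean bound stops once the predecessor is at most x. The upper estimate
  -- later keeps the number of grid intervals linear in T/s.
  ceiling : ∀ x → 0# ≤ x → ∃[ n ] (x ≤ fromℕ n × fromℕ n ≤ x + 1#)
  ceiling x 0≤x = descend (proj₁ (archimedean x)) (proj₂ (archimedean x))
    where
    descend : ∀ n → x ≤ fromℕ n → ∃[ n ] (x ≤ fromℕ n × fromℕ n ≤ x + 1#)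
    descend zero    x≤0 = zero , x≤0 , +-nonNeg 0≤x (<⇒≤ 0<1)
    descend (suc n) x≤1+n with ≤-total x (fromℕ n)
    ... | inj₁ x≤n = descend n x≤n
    ... | inj₂ n≤x = suc n , x≤1+n , ≤-trans (+-monoʳ-≤ 1# n≤x) (≤-reflexive (+-comm 1# x))

-- The exponential, logarithm and square root from Euler's limit.

module Exponential (em : ExcludedMiddle 0ℓ) (ℝ : CompleteOrderedField) where

  open CompleteOrderedField ℝ
  open Analysis em ℝ
  open OrderedField em ℝ
  open Mult semiring using (×-homo-+)
  open Exp semiring using (^-homo-*)
  open import Relation.Binary.Reasoning.Setoid setoid

  some-spec : ∀ P → ∃ P → P (some P)
  some-spec P p with em {∃ P}
  ... | yes (_ , Px) = Px
  ... | no  ¬p       = ⊥-elim (¬p p)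

  -- A convex power lies above its tangent at a.
  ^-tangent : ∀ n {a b} → 0# ≤ a → 0# ≤ b →
              a ^ suc n + fromℕ (suc n) * a ^ n * (b - a) ≤ b ^ suc n
  ^-tangent zero {a} {b} 0≤a 0≤b = ≤-reflexive
    (solve 2 (λ a b → a :* :1 :+ # 1 :* :1 :* (b :- a) := b :* :1) a b)
  ^-tangent (suc n) {a} {b} 0≤a 0≤b =
    ≤-by (+-nonNeg (*-nonNeg 0≤b (≤⇒0≤ (^-tangent n 0≤a 0≤b)))
                   (*-nonNeg (*-nonNeg (0≤fromℕ (suc n)) (^-nonNeg n 0≤a)) (0≤x² (b - a))))
         (solve 5 (λ a b p q k → b :* q := a :* (a :* p) :+ (:1 :+ k) :* (a :* p) :* (b :- a) :+
                     (b :* (q :- (a :* p :+ k :* p :* (b :- a))) :+ k :* p :* ((b :- a) :* (b :- a))))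
            a b (a ^ n) (b ^ suc n) (fromℕ (suc n)))

  1^n≈1 : ∀ n → 1# ^ n ≈ 1#
  1^n≈1 zero    = refl
  1^n≈1 (suc n) = trans (*-identityˡ _) (1^n≈1 n)

  -- The tangent to the power at 1.
  bernoulli : ∀ n {b} → 0# ≤ b → 1# + fromℕ (suc n) * (b - 1#) ≤ b ^ suc n
  bernoulli n {b} 0≤b = ≤-resp
    (+-cong (1^n≈1 (suc n)) (*-congʳ (trans (*-congˡ (1^n≈1 n)) (*-identityʳ _)))) refl
    (^-tangent n (<⇒≤ 0<1) 0≤b)

  euler : ℕ → Carrier → Carrier
  euler n x = (1# + x / fromℕ (suc n)) ^ suc n

  -- From this index on, 1 + x/k is positive and euler is increasing.
  Large : ℕ → Carrier → Set
  Large n x = - x < fromℕ (suc n)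

  base-cong : ∀ n {x y} → x ≈ y → 1# + x / fromℕ (suc n) ≈ 1# + y / fromℕ (suc n)
  base-cong n x≈y = +-congˡ (*-congʳ x≈y)

  euler-cong : ∀ n {x y} → x ≈ y → euler n x ≈ euler n y
  euler-cong n x≈y = ^-cong (suc n) (base-cong n x≈y)

  Large-mono : ∀ {m n x} → m ℕ.≤ n → Large m x → Large n x
  Large-mono m≤n large = <-≤-trans large (fromℕ-mono (ℕ.s≤s m≤n))

  large : ∀ x → ∃[ n ] Large n x
  large x with archimedean (- x)
  ... | n , -x≤n = n , ≤-<-trans -x≤n (<-by 0<1 (+-comm 1# (fromℕ n)))

  -- Multiplied by k = `fromℕ (suc n)`, the base becomes k + x.
  0<base : ∀ n x → Large n x → 0# < 1# + x / fromℕ (suc n)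
  0<base n x large-n = *-pos⁻ (0≤fromℕ (suc n)) $ <-resp refl
    (begin
      fromℕ (suc n) - - x                            ≈⟨ solve 2 (λ k x → k :- :- x := k :* :1 :+ :1 :* x) k x ⟩
      k * 1# + 1# * x                                ≈⟨ +-congˡ (*-congʳ (x*x⁻¹≈1 (0<fromℕ n))) ⟨
      k * 1# + k * k ⁻¹ * x                          ≈⟨ solve 3 (λ k k⁻¹ x → k :* :1 :+ k :* k⁻¹ :* x := k :* (:1 :+ x :* k⁻¹)) k (k ⁻¹) x ⟩
      k * (1# + x / k)                               ∎)
    (<⇒0< large-n)
    where
    k = fromℕ (suc n)

  0<euler : ∀ n x → Large n x → 0# < euler n x
  0<euler n x large-n = ^-pos (suc n) (0<base n x large-n)

  -- Take the tangent to the power k + 1 at a = 1 + x/k and evaluate it at b = 1 + x/(k + 1). Since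
  -- (k + 1)(b - a) = 1 - a, its value there is exactly a^k.
  euler-step : ∀ n x → Large n x → euler n x ≤ euler (suc n) x
  euler-step n x large-n = ≤-resp
    (begin
      a * p + l * p * (b - a)          ≈⟨ solve 4 (λ a b l p → a :* p :+ l :* p :* (b :- a) := a :* p :+ p :* (l :* (b :- a))) a b l p ⟩
      a * p + p * (l * (b - a))        ≈⟨ +-congˡ (*-congˡ l[b-a]≈1-a) ⟩
      a * p + p * (1# - a)             ≈⟨ solve 2 (λ a p → a :* p :+ p :* (:1 :- a) := p) a p ⟩
      p                                ∎)
    refl
    (^-tangent (suc n) (<⇒≤ (0<base n x large-n)) (<⇒≤ (0<base (suc n) x (Large-mono (ℕ.n≤1+n n) large-n))))
    where
    k l a b p : Carrier
    k = fromℕ (suc n)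
    l = fromℕ (suc (suc n))
    a = 1# + x / k
    b = 1# + x / l
    p = a ^ suc n
    l[b-a]≈1-a : l * (b - a) ≈ 1# - a
    l[b-a]≈1-a = begin
      l * (b - a)                                   ≈⟨ solve 4 (λ x k k⁻¹ l⁻¹ → (:1 :+ k) :* ((:1 :+ x :* l⁻¹) :- (:1 :+ x :* k⁻¹))
                                                         := x :* ((:1 :+ k) :* l⁻¹) :- x :* (k :* k⁻¹) :- x :* k⁻¹) x k (k ⁻¹) (l ⁻¹) ⟩
      x * (l * l ⁻¹) - x * (k * k ⁻¹) - x / k       ≈⟨ +-congʳ (+-cong (*-congˡ (x*x⁻¹≈1 (0<fromℕ (suc n))))
                                                                       (-‿cong (*-congˡ (x*x⁻¹≈1 (0<fromℕ n))))) ⟩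
      x * 1# - x * 1# - x / k                       ≈⟨ solve 2 (λ x y → x :* :1 :- x :* :1 :- y := :1 :- (:1 :+ y)) x (x / k) ⟩
      1# - a                                        ∎

  euler-mono : ∀ {m n} x → Large m x → m ℕ.≤ n → euler m x ≤ euler n x
  euler-mono {m} x large-m m≤n = go (ℕ.≤⇒≤′ m≤n)
    where
    go : ∀ {n} → m ℕ.≤′ n → euler m x ≤ euler n x
    go ℕ.≤′-refl            = ≤-refl
    go (ℕ.≤′-step {n} m≤′n) = ≤-trans (go m≤′n) (euler-step n x (Large-mono (ℕ.≤′⇒≤ m≤′n) large-m))

  -- AM–GM: (1 + x/k)(1 + y/k) ≤ (1 + (x + y)/2k)².
  euler-* : ∀ n x y → Large n x → Large n y → euler n x * euler n y ≤ euler (n ℕ.+ suc n) (x + y)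
  euler-* n x y large-x large-y = ≤-resp (^-distrib-* a b (suc n))
    (trans (^-distrib-* c c (suc n)) (sym (^-homo-* c (suc n) (suc n))))
    (^-mono-≤ (suc n) (*-nonNeg (<⇒≤ (0<base n x large-x)) (<⇒≤ (0<base n y large-y)))
      (≤-by (0≤x² ((x - y) * h))
        (begin
          c * c                                            ≈⟨ solve 3 (λ x y h → (:1 :+ (x :+ y) :* h) :* (:1 :+ (x :+ y) :* h)
                                                                := (:1 :+ x :* (h :+ h)) :* (:1 :+ y :* (h :+ h)) :+
                                                                   (x :- y) :* h :* ((x :- y) :* h)) x y h ⟩
          (1# + x * (h + h)) * (1# + y * (h + h)) + (x - y) * h * ((x - y) * h)
                                                           ≈⟨ +-congʳ (*-cong (+-congˡ (*-congˡ k⁻¹≈h+h)) (+-congˡ (*-congˡ k⁻¹≈h+h))) ⟨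
          a * b + (x - y) * h * ((x - y) * h)              ∎)))
    where
    k k₂ h a b c : Carrier
    k  = fromℕ (suc n)
    k₂ = fromℕ (suc n ℕ.+ suc n)
    h  = k₂ ⁻¹
    a  = 1# + x / k
    b  = 1# + y / k
    c  = 1# + (x + y) / k₂
    k⁻¹≈h+h : k ⁻¹ ≈ h + h
    k⁻¹≈h+h = begin
      k ⁻¹                      ≈⟨ *-identityʳ _ ⟨
      k ⁻¹ * 1#                 ≈⟨ *-congˡ (x*x⁻¹≈1 (0<fromℕ (n ℕ.+ suc n))) ⟨
      k ⁻¹ * (k₂ * h)           ≈⟨ *-congˡ (*-congʳ (×-homo-+ 1# (suc n) (suc n))) ⟩
      k ⁻¹ * ((k + k) * h)      ≈⟨ solve 3 (λ k k⁻¹ h → k⁻¹ :* ((k :+ k) :* h) := k :* k⁻¹ :* (h :+ h)) k (k ⁻¹) h ⟩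
      k * k ⁻¹ * (h + h)        ≈⟨ *-congʳ (x*x⁻¹≈1 (0<fromℕ n)) ⟩
      1# * (h + h)              ≈⟨ *-identityˡ _ ⟩
      h + h                     ∎

  euler-0 : ∀ n → euler n 0# ≈ 1#
  euler-0 n = trans (^-cong (suc n) (trans (+-congˡ (zeroˡ _)) (+-identityʳ 1#))) (1^n≈1 (suc n))

  -- By `euler-*` a value at x times a value at -x is at most a value at 0, which is 1. So a single
  -- positive value at -x bounds all `Large` values at x.
  euler-bounded : ∀ x → ∃[ b ] (∀ n → Large n x → euler n x ≤ b)
  euler-bounded x = let m , large-m = large (- x) in 1# / euler m (- x) , λ n large-n →
    let n≤n+m = ℕ.m≤m+n n m ; m≤n+m = ℕ.m≤n+m m n in
    *≤⇒≤/ (0<euler m (- x) large-m) $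
    ≤-trans (*-mono-≤ (<⇒≤ (0<euler n x large-n)) (<⇒≤ (0<euler m (- x) large-m))
                      (euler-mono x large-n n≤n+m) (euler-mono (- x) large-m m≤n+m)) $
    ≤-trans (euler-* (n ℕ.+ m) x (- x) (Large-mono n≤n+m large-n) (Large-mono m≤n+m large-m)) $
    ≤-reflexive (trans (euler-cong (n ℕ.+ m ℕ.+ suc (n ℕ.+ m)) (-‿inverseʳ x)) (euler-0 (n ℕ.+ m ℕ.+ suc (n ℕ.+ m))))

  -- Monotone convergence. The supremum runs over `Large` indices only: earlier, an even power of a
  -- negative base can exceed the limit.
  euler-converges : ∀ x → ∃ (ConvergesTo (λ n → euler n x))
  euler-converges x = case complete Values values (bound , λ where
                             y (n , large-n , y≈) → ≤-trans (≤-reflexive y≈) (bounded n large-n)) of λ where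
      (s , s-ub , s-least) → s , λ ε 0<ε → case em {∃[ n ] (Large n x × s - ε < euler n x)} of λ where
        (yes (m , large-m , s-ε<)) → m , λ n m≤n →
            <-≤-trans s-ε< (euler-mono x large-m m≤n)
          , ≤-<-trans (s-ub (euler n x) (n , Large-mono m≤n large-m , refl)) (<-by 0<ε refl)
        (no ¬∃) → ⊥-elim $ <⇒≱ (<-by 0<ε (solve 2 (λ s ε → s := s :- ε :+ ε) s ε)) $ s-least (s - ε) λ where
          y (n , large-n , y≈) → ≤-trans (≤-reflexive y≈) (≮⇒≥ λ s-ε< → ¬∃ (n , large-n , s-ε<))
    where
    bound   = proj₁ (euler-bounded x)
    bounded = proj₂ (euler-bounded x)
    Values : Carrier → Set
    Values y = ∃[ n ] (Large n x × y ≈ euler n x)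
    values : ∃ Values
    values = euler (proj₁ (large x)) x , proj₁ (large x) , proj₂ (large x) , refl

  exp-limit : ∀ x → ConvergesTo (λ n → euler n x) (exp x)
  exp-limit x = some-spec (ConvergesTo (λ n → euler n x)) (euler-converges x)

  -- With `exp≤` this identifies `exp x` as the supremum of the `Large` terms, so that later
  -- arguments need no ε.
  euler≤exp : ∀ n x → Large n x → euler n x ≤ exp x
  euler≤exp n x large-n = ≮⇒≥ λ exp< → case exp-limit x _ (<⇒0< exp<) of λ where
    (N , near) → <⇒≱ (proj₂ (near (n ℕ.+ N) (ℕ.m≤n+m N n)))
      (≤-trans (≤-reflexive (solve 2 (λ a b → a :+ (b :- a) := b) (exp x) (euler n x)))
               (euler-mono x large-n (ℕ.m≤m+n n N)))

  exp≤ : ∀ m x {b} → (∀ n → m ℕ.≤ n → euler n x ≤ b) → exp x ≤ b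
  exp≤ m x {b} bounded = ≮⇒≥ λ b< → case exp-limit x _ (<⇒0< b<) of λ where
    (N , near) → <⇒≱ (proj₁ (near (m ℕ.+ N) (ℕ.m≤n+m N m)))
      (≤-trans (bounded (m ℕ.+ N) (ℕ.m≤m+n m N))
               (≤-reflexive (solve 2 (λ a b → b := a :- (a :- b)) (exp x) b)))

  -- The index `n ℕ.+ suc n` belongs to the exponent 2k with k = `suc n`, the one produced by
  -- `euler-*`; the two strict bounds add up.
  Large-+ : ∀ n x y → Large n x → Large n y → Large (n ℕ.+ suc n) (x + y)
  Large-+ n x y large-x large-y = <-by (+-pos (<⇒0< large-x) (<⇒≤ (<⇒0< large-y)))
    (trans (×-homo-+ 1# (suc n) (suc n))
           (solve 3 (λ k x y → k :+ k := :- (x :+ y) :+ ((k :- :- x) :+ (k :- :- y))) (fromℕ (suc n)) x y))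

  0<exp : ∀ x → 0# < exp x
  0<exp x = let n , large-n = large x in <-≤-trans (0<euler n x large-n) (euler≤exp n x large-n)

  -- `exp` is a choice made by `some` from a predicate that depends on x, so compatibility with ≈
  -- has to come from the supremum property.
  exp-cong-≤ : ∀ {x y} → x ≈ y → exp x ≤ exp y
  exp-cong-≤ {x} {y} x≈y = let m , large-m = large y in exp≤ m x λ n m≤n →
    ≤-trans (≤-reflexive (euler-cong n x≈y)) (euler≤exp n y (Large-mono m≤n large-m))

  exp-cong : ∀ {x y} → x ≈ y → exp x ≈ exp y
  exp-cong x≈y = ≤-antisym (exp-cong-≤ x≈y) (exp-cong-≤ (sym x≈y))

  -- The supremum is taken in one factor at a time, dividing by the other, positive one. Terms of
  -- different indices m and n are first raised to the common index m + n.
  exp-superadditive : ∀ x y → exp x * exp y ≤ exp (x + y)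
  exp-superadditive x y = let k , large-k = large x ; l , large-l = large y in
    ≤-trans (≤-reflexive (*-comm _ _)) $ ≤/⇒*≤ (0<exp x) $ exp≤ l y λ n l≤n →
    *≤⇒≤/ (0<exp x) $ ≤-trans (≤-reflexive (*-comm _ _)) $
    ≤/⇒*≤ (0<euler n y (Large-mono l≤n large-l)) $ exp≤ k x λ m k≤m →
    *≤⇒≤/ (0<euler n y (Large-mono l≤n large-l)) $ product m n (Large-mono k≤m large-k) (Large-mono l≤n large-l)
    where
    product : ∀ m n → Large m x → Large n y → euler m x * euler n y ≤ exp (x + y)
    product m n large-m large-n =
      ≤-trans (*-mono-≤ (<⇒≤ (0<euler m x large-m)) (<⇒≤ (0<euler n y large-n))
                        (euler-mono x large-m (ℕ.m≤m+n m n)) (euler-mono y large-n (ℕ.m≤n+m n m))) $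
      ≤-trans (euler-* (m ℕ.+ n) x y (Large-mono (ℕ.m≤m+n m n) large-m) (Large-mono (ℕ.m≤n+m n m) large-n)) $
      euler≤exp (m ℕ.+ n ℕ.+ suc (m ℕ.+ n)) (x + y) (Large-+ (m ℕ.+ n) x y (Large-mono (ℕ.m≤m+n m n) large-m) (Large-mono (ℕ.m≤n+m n m) large-n))

  exp-0 : exp 0# ≈ 1#
  exp-0 = ≤-antisym
    (exp≤ 0 0# λ n _ → ≤-reflexive (euler-0 n))
    (≤-resp (euler-0 0) refl (euler≤exp 0 0# (<-resp (sym (solve 0 (:- # 0 := # 0))) refl (0<fromℕ 0))))

  -- The bases multiply to 1 - x²/k², so Bernoulli gives at least 1 - x²/k for the product of the
  -- k-th powers. A deficit δ would force k ≤ x²/δ for all large k.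
  1≤exp*exp⁻ : ∀ x → 1# ≤ exp x * exp (- x)
  1≤exp*exp⁻ x = ≮⇒≥ λ e< → case archimedean (x * x / (1# - exp x * exp (- x))) of λ where
    (N , x²/δ≤N) →
      let m , large-m = large x ; m′ , large-m′ = large (- x)
          n = N ℕ.+ (m ℕ.+ m′)
          large-n  = Large-mono (ℕ.≤-trans (ℕ.m≤m+n m m′) (ℕ.m≤n+m _ N)) large-m
          large-n′ = Large-mono (ℕ.≤-trans (ℕ.m≤n+m m′ m) (ℕ.m≤n+m _ N)) large-m′
          k = fromℕ (suc n)
          δ = 1# - exp x * exp (- x)
          a = 1# + x / k
          b = 1# + - x / k
          1-x²/k≤e : 1# - x * x / k ≤ exp x * exp (- x)
          1-x²/k≤e = ≤-trans
            (≤-resp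
              (begin
                1# + k * (a * b - 1#)              ≈⟨ solve 3 (λ x k k⁻¹ → :1 :+ k :* ((:1 :+ x :* k⁻¹) :* (:1 :+ :- x :* k⁻¹) :- :1)
                                                        := :1 :- x :* x :* k⁻¹ :* (k :* k⁻¹)) x k (k ⁻¹) ⟩
                1# - x * x / k * (k * k ⁻¹)        ≈⟨ +-congˡ (-‿cong (trans (*-congˡ (x*x⁻¹≈1 (0<fromℕ n))) (*-identityʳ _))) ⟩
                1# - x * x / k                     ∎)
              (^-distrib-* a b (suc n))
              (bernoulli n (*-nonNeg (<⇒≤ (0<base n x large-n)) (<⇒≤ (0<base n (- x) large-n′)))))
            (*-mono-≤ (<⇒≤ (0<euler n x large-n)) (<⇒≤ (0<euler n (- x) large-n′))
                      (euler≤exp n x large-n) (euler≤exp n (- x) large-n′))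
          δ*k≤x² : k * δ ≤ x * x
          δ*k≤x² = ≤-trans (≤-reflexive (*-comm k δ)) $ ≤/⇒*≤ (0<fromℕ n) $
            ≤-by (≤⇒0≤ 1-x²/k≤e) (solve 2 (λ e q → q := :1 :- e :+ (e :- (:1 :- q))) (exp x * exp (- x)) (x * x / k))
      in <⇒≱ (<-by 0<1 (+-comm 1# (fromℕ n)))
           (≤-trans (*≤⇒≤/ (<⇒0< e<) δ*k≤x²) (≤-trans x²/δ≤N (fromℕ-mono (ℕ.m≤m+n N (m ℕ.+ m′)))))

  -- The missing direction: exp(x + y) ≤ exp(x + y) exp(-y) exp(y) ≤ exp(x) exp(y), by
  -- superadditivity for x + y and -y.
  exp-+ : ∀ x y → exp (x + y) ≈ exp x * exp y
  exp-+ x y = ≤-antisym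
    (≤-trans
      (≤-resp (*-identityʳ _) (solve 3 (λ a b c → a :* (b :* c) := a :* c :* b) (exp (x + y)) (exp y) (exp (- y)))
              (*-monoˡ-≤ (exp (x + y)) (<⇒≤ (0<exp (x + y))) (1≤exp*exp⁻ y)))
      (*-mono-≤ (*-nonNeg (<⇒≤ (0<exp _)) (<⇒≤ (0<exp _))) (<⇒≤ (0<exp y))
        (≤-trans (exp-superadditive (x + y) (- y)) (exp-cong-≤ (solve 2 (λ x y → x :+ y :+ :- y := x) x y)))
        ≤-refl))
    (exp-superadditive x y)

  1+x≤exp : ∀ x → 1# + x ≤ exp x
  1+x≤exp x = let n , large-n = large x ; k = fromℕ (suc n) in ≤-trans
    (≤-resp
      (+-congˡ (begin
        k * (1# + x / k - 1#)     ≈⟨ solve 3 (λ x k k⁻¹ → k :* (:1 :+ x :* k⁻¹ :- :1) := x :* (k :* k⁻¹)) x k (k ⁻¹) ⟩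
        x * (k * k ⁻¹)            ≈⟨ *-congˡ (x*x⁻¹≈1 (0<fromℕ n)) ⟩
        x * 1#                    ≈⟨ *-identityʳ x ⟩
        x                         ∎))
      refl (bernoulli n (<⇒≤ (0<base n x large-n))))
    (euler≤exp n x large-n)

  -- exp y = exp x · exp(y - x) ≥ exp x · (1 + (y - x)).
  exp-mono-< : ∀ {x y} → x < y → exp x < exp y
  exp-mono-< {x} {y} x<y = <-≤-trans
    (<-by (*-pos (0<exp x) (<⇒0< x<y)) refl)
    (≤-resp
      (solve 3 (λ x y e → e :* (:1 :+ (y :- x)) := e :+ e :* (y :- x)) x y (exp x))
      (trans (sym (exp-+ x (y - x))) (exp-cong (solve 2 (λ x y → x :+ (y :- x) := y) x y)))
      (*-monoˡ-≤ (exp x) (<⇒≤ (0<exp x)) (1+x≤exp (y - x))))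

  exp-cancel-≤ : ∀ {x y} → exp x ≤ exp y → x ≤ y
  exp-cancel-≤ ex≤ey = ≮⇒≥ λ y<x → <⇒≱ (exp-mono-< y<x) ex≤ey

  exp-injective : ∀ {x y} → exp x ≈ exp y → x ≈ y
  exp-injective p = ≤-antisym (exp-cancel-≤ (≤-reflexive p)) (exp-cancel-≤ (≤-reflexive (sym p)))

  exp*exp⁻≈1 : ∀ x → exp x * exp (- x) ≈ 1#
  exp*exp⁻≈1 x = trans (sym (exp-+ x (- x))) (trans (exp-cong (-‿inverseʳ x)) exp-0)

  -- This is 1 - h ≤ exp(-h) multiplied by exp h; it bounds exp h from above for small h.
  [1-h]*exp≤1 : ∀ h → (1# - h) * exp h ≤ 1#
  [1-h]*exp≤1 h = ≤-resp (*-comm _ _) (exp*exp⁻≈1 h) (*-monoˡ-≤ (exp h) (<⇒≤ (0<exp h)) (1+x≤exp (- h)))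

  -- The supremum of { x ∣ exp x ≤ a } solves exp x ≈ a; the bounds 1 + h ≤ exp h ≤ 1/(1 - h)
  -- provide the continuity needed at the supremum.
  exp-surjective : ∀ a → 0# < a → ∃[ x ] exp x ≈ a
  exp-surjective a 0<a = case complete Below below (a , bound) of λ where
      (s , s-ub , s-least) → s , ≤-antisym
        (≮⇒≥ λ a<es →
          -- This h solves exp s · (1 - h) = a, which makes s - h a smaller upper bound.
          let h = (exp s - a) / exp s
              0<h = 0<x/y (<⇒0< a<es) (0<exp s)
              a≤ : a ≤ exp (s - h)
              a≤ = ≤-resp
                (begin
                  exp s * (1# + - h)              ≈⟨ solve 2 (λ e h → e :* (:1 :+ :- h) := e :- h :* e) (exp s) h ⟩
                  exp s - h * exp s               ≈⟨ +-congˡ (-‿cong ([x/y]*y≈x _ (0<exp s))) ⟩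
                  exp s - (exp s - a)             ≈⟨ solve 2 (λ e a → e :- (e :- a) := a) (exp s) a ⟩
                  a                               ∎)
                (sym (exp-+ s (- h)))
                (*-monoˡ-≤ (exp s) (<⇒≤ (0<exp s)) (1+x≤exp (- h)))
          in <⇒≱ (<-by 0<h (solve 2 (λ s h → s := s :- h :+ h) s h))
                 (s-least (s - h) λ x ex≤a → exp-cancel-≤ (≤-trans ex≤a a≤)))
        (≮⇒≥ λ es<a →
          -- This h solves a (1 - h) = exp s, which puts s + h into `Below`.
          let h = (a - exp s) / a
              0<h = 0<x/y (<⇒0< es<a) 0<a
              a[1-h]≈es : a * (1# - h) ≈ exp s
              a[1-h]≈es = begin
                a * (1# - h)                      ≈⟨ solve 2 (λ a h → a :* (:1 :- h) := a :- h :* a) a h ⟩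
                a - h * a                         ≈⟨ +-congˡ (-‿cong ([x/y]*y≈x _ 0<a)) ⟩
                a - (a - exp s)                   ≈⟨ solve 2 (λ e a → a :- (a :- e) := e) (exp s) a ⟩
                exp s                             ∎
              e[s+h]≤a : exp (s + h) ≤ a
              e[s+h]≤a = ≤-resp (sym (exp-+ s h)) (*-identityʳ a) $ ≤-resp
                (trans (solve 3 (λ a h e → a :* ((:1 :- h) :* e) := a :* (:1 :- h) :* e) a h (exp h)) (*-congʳ a[1-h]≈es)) refl
                (*-monoˡ-≤ a (<⇒≤ 0<a) ([1-h]*exp≤1 h))
          in <⇒≱ (<-by 0<h refl) (s-ub (s + h) e[s+h]≤a))
    where
    Below : Carrier → Set
    Below x = exp x ≤ a
    bound : UpperBound Below a
    bound x ex≤a = ≤-trans (≤-by (<⇒≤ 0<1) (+-comm 1# x)) (≤-trans (1+x≤exp x) ex≤a)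
    below : ∃ Below
    -- From exp(1/a) ≥ 1/a it follows that exp(-1/a) ≤ a.
    below = - (1# / a) , *-cancelˡ-≤ (exp (1# / a)) (0<exp _)
      (≤-resp (trans ([x/y]*y≈x 1# 0<a) (sym (exp*exp⁻≈1 (1# / a)))) refl
        (*-mono-≤ (<⇒≤ (0<x/y 0<1 0<a)) (<⇒≤ 0<a)
          (≤-trans (≤-by (<⇒≤ 0<1) (+-comm 1# (1# / a))) (1+x≤exp (1# / a))) ≤-refl))

  exp-log : ∀ {x} → 0# < x → exp (log x) ≈ x
  exp-log {x} 0<x = some-spec (λ y → exp y ≈ x) (exp-surjective x 0<x)

  log-unique : ∀ {x y} → exp y ≈ x → log x ≈ y
  log-unique {x} {y} ey≈x = exp-injective (trans (exp-log (<-resp refl ey≈x (0<exp y))) (sym ey≈x))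

  exp-fromℕ* : ∀ n x → exp (fromℕ n * x) ≈ exp x ^ n
  exp-fromℕ* zero    x = trans (exp-cong (zeroˡ x)) exp-0
  exp-fromℕ* (suc n) x = trans (exp-cong (solve 2 (λ k x → (:1 :+ k) :* x := x :+ k :* x) (fromℕ n) x))
    (trans (exp-+ x (fromℕ n * x)) (*-congˡ (exp-fromℕ* n x)))

  x≈½x+½x : ∀ x → x ≈ x / fromℕ 2 + x / fromℕ 2
  x≈½x+½x x = trans (sym ([x/y]*y≈x x (0<fromℕ 1))) (solve 1 (λ y → y :* # 2 := y :+ y) (x / fromℕ 2))

  exp-½² : ∀ x → exp (x / fromℕ 2) * exp (x / fromℕ 2) ≈ exp x
  exp-½² x = trans (sym (exp-+ _ _)) (exp-cong (sym (x≈½x+½x x)))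

  -- For positive x the root is exp(½ log x). The logarithm gives nothing at 0, which is treated
  -- apart.
  sqrt-spec : ∀ x → 0# ≤ x → 0# ≤ sqrt x × sqrt x * sqrt x ≈ x
  sqrt-spec x 0≤x = some-spec (λ y → 0# ≤ y × y * y ≈ x) root
    where
    root : ∃[ y ] (0# ≤ y × y * y ≈ x)
    root with em {0# ≈ x}
    ... | yes 0≈x = 0# , ≤-refl , trans (zeroˡ 0#) 0≈x
    ... | no  0≉x = exp (log x / fromℕ 2) , <⇒≤ (0<exp _) ,
      trans (exp-½² (log x)) (exp-log (0≤x , 0≉x))

  -- Turns a natural power of √x, in its exponential form, into the real power x^(n/2) of the final
  -- bound.
  exp-½^ : ∀ x n → exp (log x / fromℕ 2) ^ n ≈ x ** (fromℕ n / fromℕ 2)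
  exp-½^ x n = trans (sym (exp-fromℕ* n (log x / fromℕ 2)))
    (exp-cong (solve 3 (λ k h l → k :* (l :* h) := k :* h :* l) (fromℕ n) (fromℕ 2 ⁻¹) (log x)))

-- Finite sums of field elements.

module Sums (em : ExcludedMiddle 0ℓ) (ℝ : CompleteOrderedField) where

  open CompleteOrderedField ℝ
  open OrderedField em ℝ
  open Sum semiring public using (sum-cong-≋; ∑-distrib-+; *-distribˡ-sum; sum-remove)
  open import Relation.Binary.Reasoning.Setoid setoid

  sum-linear : ∀ {n} c e (f g : Vector Carrier n) →
               sum (λ k → c * f k + e * g k) ≈ c * sum f + e * sum g
  sum-linear c e f g = trans (∑-distrib-+ (λ k → c * f k) (λ k → e * g k))
    (sym (+-cong (*-distribˡ-sum c f) (*-distribˡ-sum e g)))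

  sum-mono-≤ : ∀ {n} {f g : Vector Carrier n} → (∀ k → f k ≤ g k) → sum f ≤ sum g
  sum-mono-≤ {zero}  f≤g = ≤-refl
  sum-mono-≤ {suc n} f≤g = +-mono-≤ (f≤g zero) (sum-mono-≤ (f≤g ∘ suc))

  sum-bound : ∀ {n} {f : Vector Carrier n} {b} → (∀ k → f k ≤ b) → sum f ≤ fromℕ n * b
  sum-bound {zero}  {b = b} f≤b = ≤-reflexive (sym (zeroˡ b))
  sum-bound {suc n} {b = b} f≤b = ≤-trans (+-mono-≤ (f≤b zero) (sum-bound (f≤b ∘ suc)))
    (≤-reflexive (solve 2 (λ k b → b :+ k :* b := (:1 :+ k) :* b) (fromℕ n) b))

  sum-nonNeg : ∀ {n} {f : Vector Carrier n} → (∀ k → 0# ≤ f k) → 0# ≤ sum f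
  sum-nonNeg {zero}  0≤f = ≤-refl
  sum-nonNeg {suc n} 0≤f = +-nonNeg (0≤f zero) (sum-nonNeg (0≤f ∘ suc))

  term≤sum : ∀ {n} {f : Vector Carrier n} → (∀ k → 0# ≤ f k) → ∀ k → f k ≤ sum f
  term≤sum 0≤f zero    = ≤-by (sum-nonNeg (0≤f ∘ suc)) refl
  term≤sum 0≤f (suc k) = ≤-trans (term≤sum (0≤f ∘ suc) k) (≤-by (0≤f zero) (+-comm _ _))

  1≤4^n : ∀ n → 1# ≤ fromℕ 4 ^ n
  1≤4^n zero    = ≤-refl
  1≤4^n (suc n) = ≤-trans (1≤4^n n)
    (≤-by (*-nonNeg (0≤fromℕ 3) (^-nonNeg n (0≤fromℕ 4))) (solve 1 (λ p → # 4 :* p := p :+ # 3 :* p) (fromℕ 4 ^ n)))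

  -- By induction, (a + s)² ≤ 2a² + 2s² ≤ 2b + 2pb ≤ 4pb with p ≥ 1. The constant 4^n is cruder than
  -- n² but needs only this step.
  sum-square-bound : ∀ {n} (f : Vector Carrier n) {b} → 0# ≤ b → (∀ k → f k * f k ≤ b) →
                     sum f * sum f ≤ fromℕ 4 ^ n * b
  sum-square-bound {zero}  f {b} 0≤b f²≤b = ≤-resp (sym (zeroˡ 0#)) (sym (*-identityˡ b)) 0≤b
  sum-square-bound {suc n} f {b} 0≤b f²≤b =
    ≤-by (+-nonNeg (0≤x² (a - s)) (+-nonNeg a²≤b (+-nonNeg a²≤b (+-nonNeg s²≤pb (+-nonNeg s²≤pb (+-nonNeg p≥1 p≥1))))))
      (solve 4 (λ a s p b → # 4 :* p :* b := (a :+ s) :* (a :+ s) :+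
          ((a :- s) :* (a :- s) :+ ((b :- a :* a) :+ ((b :- a :* a) :+ ((p :* b :- s :* s) :+ ((p :* b :- s :* s) :+
           ((p :- :1) :* b :+ (p :- :1) :* b))))))) a s p b)
    where
    a s p : Carrier
    a = f zero
    s = sum (f ∘ suc)
    p = fromℕ 4 ^ n
    a²≤b : 0# ≤ b - a * a
    a²≤b = ≤⇒0≤ (f²≤b zero)
    s²≤pb : 0# ≤ p * b - s * s
    s²≤pb = ≤⇒0≤ (sum-square-bound (f ∘ suc) 0≤b (f²≤b ∘ suc))
    p≥1 : 0# ≤ (p - 1#) * b
    p≥1 = *-nonNeg (≤⇒0≤ (1≤4^n n)) 0≤b

-- Counting by injective codes.

module Counting where

  lookup-injective : ∀ {A : Set} {xs : List A} → Unique xs → ∀ i j → lookup xs i ≡ lookup xs j → i ≡ j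
  lookup-injective (x∉ ∷ xs!) zero    zero    eq = ≡.refl
  lookup-injective (x∉ ∷ xs!) zero    (suc j) eq = ⊥-elim (All.lookup x∉ (∈-lookup j) eq)
  lookup-injective (x∉ ∷ xs!) (suc i) zero    eq = ⊥-elim (All.lookup x∉ (∈-lookup i) (≡.sym eq))
  lookup-injective (x∉ ∷ xs!) (suc i) (suc j) eq = ≡.cong suc (lookup-injective xs! i j eq)

  -- The filtered list has no repetitions, so `code` after `lookup` injects its positions into
  -- `Fin k`.
  length-filter≤ : ∀ {m k} {P : Pred (Fin m) 0ℓ} (P? : Decidable P) (code : Fin m → Fin k) →
                   (∀ i j → P i → P j → code i ≡ code j → i ≡ j) →
                   length (filter P? (allFin m)) ℕ.≤ k
  length-filter≤ {m} {P = P} P? code code-injective = Fin.injective⇒≤ {f = code ∘ lookup xs} λ {i} {j} eq →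
    lookup-injective (filter⁺ P? (allFin⁺ m)) i j
      (code-injective _ _ (All.lookup (all-filter P? (allFin m)) (∈-lookup i)) (All.lookup (all-filter P? (allFin m)) (∈-lookup j)) eq)
    where
    xs : List (Fin m)
    xs = filter P? (allFin m)

  foldr-⊔≤ : ∀ {m k} (f : Vector ℕ m) → (∀ i → f i ℕ.≤ k) → Vector.foldr ℕ._⊔_ 0 f ℕ.≤ k
  foldr-⊔≤ {zero}  f f≤k = ℕ.z≤n
  foldr-⊔≤ {suc m} f f≤k = ℕ.⊔-lub (f≤k zero) (foldr-⊔≤ (f ∘ suc) (f≤k ∘ suc))

-- Euclidean geometry in squared distances.

module Metric (em : ExcludedMiddle 0ℓ) (ℝ : CompleteOrderedField) (d : ℕ) where

  open CompleteOrderedField ℝ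
  open OrderedField em ℝ
  open Sums em ℝ
  open Analysis em ℝ
  open Exponential em ℝ
  open Geometry em ℝ d
  open import Relation.Binary.Reasoning.Setoid setoid

  ∥_∥² : Point → Carrier
  ∥ x ∥² = sum (λ k → x k * x k)

  dist² : Point → Point → Carrier
  dist² x y = ∥ (λ k → x k - y k) ∥²

  0≤∥x∥² : ∀ x → 0# ≤ ∥ x ∥²
  0≤∥x∥² x = sum-nonNeg λ k → 0≤x² (x k)

  ∥∥²-cong : ∀ {x y} → x ≋ y → ∥ x ∥² ≈ ∥ y ∥²
  ∥∥²-cong x≋y = sum-cong-≋ λ k → *-cong (x≋y k) (x≋y k)

  0≤norm : ∀ x → 0# ≤ norm x
  0≤norm x = proj₁ (sqrt-spec ∥ x ∥² (0≤∥x∥² x))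

  norm²≈∥∥² : ∀ x → norm x * norm x ≈ ∥ x ∥²
  norm²≈∥∥² x = proj₂ (sqrt-spec ∥ x ∥² (0≤∥x∥² x))

  norm≈ : ∀ {x s} → 0# ≤ s → ∥ x ∥² ≈ s * s → norm x ≈ s
  norm≈ {x} 0≤s ∥x∥²≈s² = square-cancel-≈ (0≤norm x) 0≤s (trans (norm²≈∥∥² x) ∥x∥²≈s²)

  dist²-sym : ∀ x y → dist² x y ≈ dist² y x
  dist²-sym x y = sum-cong-≋ λ k → solve 2 (λ a b → (a :- b) :* (a :- b) := (b :- a) :* (b :- a)) (x k) (y k)

  dist-sym : ∀ x y → dist x y ≈ dist y x
  dist-sym x y = norm≈ (0≤norm _) (trans (dist²-sym x y) (sym (norm²≈∥∥² _)))

  dist≤⇒dist²≤ : ∀ {x y s} → dist x y ≤ s → dist² x y ≤ s * s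
  dist≤⇒dist²≤ dxy≤s = ≤-trans (≤-reflexive (sym (norm²≈∥∥² _))) (square-mono-≤ (0≤norm _) dxy≤s)

  ≤dist⇒≤dist² : ∀ {x y s} → 0# ≤ s → s ≤ dist x y → s * s ≤ dist² x y
  ≤dist⇒≤dist² 0≤s s≤dxy = ≤-trans (square-mono-≤ 0≤s s≤dxy) (≤-reflexive (norm²≈∥∥² _))

  dist≤dist⇒dist²≤dist² : ∀ {x y u v} → dist x y ≤ dist u v → dist² x y ≤ dist² u v
  dist≤dist⇒dist²≤dist² p = ≤-trans (dist≤⇒dist²≤ p) (≤-reflexive (norm²≈∥∥² _))

  dist²-triangle : ∀ x y z → dist² x z ≤ fromℕ 2 * dist² x y + fromℕ 2 * dist² y z
  dist²-triangle x y z = ≤-trans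
    (sum-mono-≤ λ k → ≤-by (0≤x² (x k - y k - (y k - z k)))
      (solve 3 (λ x y z → # 2 :* ((x :- y) :* (x :- y)) :+ # 2 :* ((y :- z) :* (y :- z)) :=
                          (x :- z) :* (x :- z) :+ (x :- y :- (y :- z)) :* (x :- y :- (y :- z))) (x k) (y k) (z k)))
    (≤-reflexive (sum-linear (fromℕ 2) (fromℕ 2) (λ k → (x k - y k) * (x k - y k)) (λ k → (y k - z k) * (y k - z k))))

  coordinate≤dist² : ∀ x y k → (x k - y k) * (x k - y k) ≤ dist² x y
  coordinate≤dist² x y = term≤sum λ k → 0≤x² (x k - y k)

  -- Written with the coefficients of `Segment` at t = 1/2, so that membership in the segment holds
  -- by `refl`.
  midpoint : Point → Point → Point
  midpoint a b k = (1# - fromℕ 2 ⁻¹) * a k + fromℕ 2 ⁻¹ * b k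

  midpoint∈Segment : ∀ a b → Segment a b (midpoint a b)
  midpoint∈Segment a b = h , <⇒≤ (0<x⁻¹ (0<fromℕ 1)) , ≤-by (<⇒≤ (0<x⁻¹ (0<fromℕ 1)))
    (trans (sym (x*x⁻¹≈1 (0<fromℕ 1))) (solve 1 (λ h → # 2 :* h := h :+ h) h)) , λ k → refl
    where
    h = fromℕ 2 ⁻¹

  -- The sum a + b is twice the midpoint, whence the 4. The factor `fromℕ 1` gives the left side the
  -- shape of `sum-linear`.
  parallelogram : ∀ a b → fromℕ 1 * dist² a b + fromℕ 4 * ∥ midpoint a b ∥² ≈ fromℕ 2 * ∥ a ∥² + fromℕ 2 * ∥ b ∥²
  parallelogram a b = begin
    fromℕ 1 * dist² a b + fromℕ 4 * ∥ midpoint a b ∥²    ≈⟨ sum-linear (fromℕ 1) (fromℕ 4) (λ k → (a k - b k) * (a k - b k))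
                                                                                              (λ k → midpoint a b k * midpoint a b k) ⟨
    sum (λ k → fromℕ 1 * ((a k - b k) * (a k - b k)) + fromℕ 4 * (midpoint a b k * midpoint a b k))
                                                         ≈⟨ sum-cong-≋ (λ k → coordinate (a k) (b k)) ⟩
    sum (λ k → fromℕ 2 * (a k * a k) + fromℕ 2 * (b k * b k))
                                                         ≈⟨ sum-linear (fromℕ 2) (fromℕ 2) (λ k → a k * a k) (λ k → b k * b k) ⟩
    fromℕ 2 * ∥ a ∥² + fromℕ 2 * ∥ b ∥²                  ∎
    where
    h : Carrier
    h = fromℕ 2 ⁻¹
    coordinate : ∀ x y → fromℕ 1 * ((x - y) * (x - y)) + fromℕ 4 * (((1# - h) * x + h * y) * ((1# - h) * x + h * y)) ≈
                 fromℕ 2 * (x * x) + fromℕ 2 * (y * y)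
    coordinate x y = begin
      fromℕ 1 * ((x - y) * (x - y)) + fromℕ 4 * (((1# - h) * x + h * y) * ((1# - h) * x + h * y))
        -- The solver does not know that 2h = 1, so `fromℕ 2 * h` is isolated first and replaced
        -- afterwards.
        ≈⟨ solve 3 (λ h x y → # 1 :* ((x :- y) :* (x :- y)) :+ # 4 :* (((:1 :- h) :* x :+ h :* y) :* ((:1 :- h) :* x :+ h :* y)) :=
             (x :- y) :* (x :- y) :+ (# 2 :* x :+ # 2 :* h :* (y :- x)) :* (# 2 :* x :+ # 2 :* h :* (y :- x))) h x y ⟩
      (x - y) * (x - y) + (fromℕ 2 * x + fromℕ 2 * h * (y - x)) * (fromℕ 2 * x + fromℕ 2 * h * (y - x))
        ≈⟨ +-congˡ (*-cong (+-congˡ (*-congʳ (x*x⁻¹≈1 (0<fromℕ 1)))) (+-congˡ (*-congʳ (x*x⁻¹≈1 (0<fromℕ 1))))) ⟩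
      (x - y) * (x - y) + (fromℕ 2 * x + 1# * (y - x)) * (fromℕ 2 * x + 1# * (y - x))
        ≈⟨ solve 2 (λ x y → (x :- y) :* (x :- y) :+ (# 2 :* x :+ :1 :* (y :- x)) :* (# 2 :* x :+ :1 :* (y :- x)) :=
             # 2 :* (x :* x) :+ # 2 :* (y :* y)) x y ⟩
      fromℕ 2 * (x * x) + fromℕ 2 * (y * y) ∎

  ∥∥²≤ : ∀ {x s} → norm x ≤ s → ∥ x ∥² ≤ s * s
  ∥∥²≤ {x} nx≤s = ≤-trans (≤-reflexive (sym (norm²≈∥∥² x))) (square-mono-≤ (0≤norm x) nx≤s)

  ≤∥∥² : ∀ {x s} → 0# ≤ s → ¬ (norm x ≤ s) → s * s ≤ ∥ x ∥²
  ≤∥∥² {x} 0≤s nx≰s = ≤-trans (square-mono-≤ 0≤s (≰⇒≥ nx≰s)) (≤-reflexive (norm²≈∥∥² x))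

  -- The midpoint lies outside B(r), so 2|a|² + 2|b|² - 4|midpoint|² is at most 4R² - 4r².
  visible⇒dist²≤ : ∀ {R r a b} → 0# ≤ r → norm a ≤ R → norm b ≤ R → Segment a b ⊆ Annulus R r →
                   dist² a b ≤ fromℕ 4 * (R * R - r * r)
  visible⇒dist²≤ {R} {r} {a} {b} 0≤r na≤R nb≤R [a,b]⊆A =
    ≤-by (+-nonNeg (*-nonNeg (0≤fromℕ 2) (≤⇒0≤ (∥∥²≤ na≤R)))
           (+-nonNeg (*-nonNeg (0≤fromℕ 2) (≤⇒0≤ (∥∥²≤ nb≤R)))
             (*-nonNeg (0≤fromℕ 4) (≤⇒0≤ (≤∥∥² 0≤r (proj₂ ([a,b]⊆A (midpoint∈Segment a b))))))))
      (begin
        fromℕ 4 * (R * R - r * r)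
          -- The last bracket is the difference of the two sides of the parallelogram law and
          -- vanishes in the next steps.
          ≈⟨ solve 6 (λ R r u v m D → # 4 :* (R :* R :- r :* r) :=
               D :+ (# 2 :* (R :* R :- u) :+ (# 2 :* (R :* R :- v) :+ # 4 :* (m :- r :* r))) :+
               (# 2 :* u :+ # 2 :* v :- (# 1 :* D :+ # 4 :* m))) R r ∥ a ∥² ∥ b ∥² ∥ midpoint a b ∥² (dist² a b) ⟩
        _ ≈⟨ +-congˡ (+-congˡ (-‿cong (parallelogram a b))) ⟩
        _ ≈⟨ solve 2 (λ x y → x :+ (y :- y) := x) _ (fromℕ 2 * ∥ a ∥² + fromℕ 2 * ∥ b ∥²) ⟩
        _ ∎)

  radial-projection : ∀ x {ρ} → 0# < norm x → 0# ≤ ρ →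
                      ∃[ z ] (Sphere ρ z × dist² x z ≈ (norm x - ρ) * (norm x - ρ))
  radial-projection x {ρ} 0<s 0≤ρ = (λ k → c * x k) , norm≈ 0≤ρ ∥cx∥²≈ρ² , dist²≈
    where
    s c : Carrier
    s = norm x
    c = ρ / s
    cs≈ρ : c * s ≈ ρ
    cs≈ρ = [x/y]*y≈x ρ 0<s
    scale : ∀ e → sum (λ k → (e * x k) * (e * x k)) ≈ (e * s) * (e * s)
    scale e = begin
      sum (λ k → (e * x k) * (e * x k))     ≈⟨ sum-cong-≋ (λ k → solve 2 (λ e x → (e :* x) :* (e :* x) := e :* e :* (x :* x)) e (x k)) ⟩
      sum (λ k → e * e * (x k * x k))       ≈⟨ *-distribˡ-sum (e * e) (λ k → x k * x k) ⟨
      e * e * ∥ x ∥²                        ≈⟨ *-congˡ (norm²≈∥∥² x) ⟨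
      e * e * (s * s)                       ≈⟨ solve 2 (λ e s → e :* e :* (s :* s) := (e :* s) :* (e :* s)) e s ⟩
      (e * s) * (e * s)                     ∎
    ∥cx∥²≈ρ² : ∥ (λ k → c * x k) ∥² ≈ ρ * ρ
    ∥cx∥²≈ρ² = trans (scale c) (*-cong cs≈ρ cs≈ρ)
    dist²≈ : dist² x (λ k → c * x k) ≈ (s - ρ) * (s - ρ)
    dist²≈ = begin
      dist² x (λ k → c * x k)               ≈⟨ ∥∥²-cong (λ k → solve 2 (λ c x → x :- c :* x := (:1 :- c) :* x) c (x k)) ⟩
      ∥ (λ k → (1# - c) * x k) ∥²           ≈⟨ scale (1# - c) ⟩
      ((1# - c) * s) * ((1# - c) * s)       ≈⟨ *-cong e e ⟩
      (s - ρ) * (s - ρ)                     ∎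
      where
      e : (1# - c) * s ≈ s - ρ
      e = trans (solve 2 (λ c s → (:1 :- c) :* s := s :- c :* s) c s) (+-congˡ (-‿cong cs≈ρ))

  -- A point z at distance at least δ from the whole system could be adjoined. Maximality then makes
  -- z one of the y_j, at distance 0 < δ from itself.
  maximal⇒covering : ∀ {ρ δ m} {y : Vector Point m} → 0# < δ → IsMaximalSystem ρ δ y →
                     ∀ z → Sphere ρ z → ∃[ j ] dist z (y j) < δ
  maximal⇒covering {ρ} {δ} {m} {y} 0<δ ((y∈S , y-separated) , maximal) z z∈S with em {∃[ j ] dist z (y j) < δ}
  ... | yes p = p
  ... | no ¬p = ⊥-elim $ case maximal (suc m) (z Vector.∷ y) (on-sphere , separated) (λ (i , x≋yᵢ) → suc i , x≋yᵢ) (zero , λ k → refl) of λ where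
      (j , z≋yⱼ) → ¬p (j , ≤-<-trans (≤-reflexive (norm≈ ≤-refl (dist²≈0 (y j) z≋yⱼ))) 0<δ)
    where
    far : ∀ j → δ ≤ dist z (y j)
    far j = ≮⇒≥ λ d<δ → ¬p (j , d<δ)
    on-sphere : ∀ i → Sphere ρ ((z Vector.∷ y) i)
    on-sphere zero    = z∈S
    on-sphere (suc i) = y∈S i
    separated : ∀ i j → i ≢ j → δ ≤ dist ((z Vector.∷ y) i) ((z Vector.∷ y) j)
    separated zero    zero    i≢j = ⊥-elim (i≢j ≡.refl)
    separated zero    (suc j) _   = far j
    separated (suc i) zero    _   = ≤-trans (far i) (≤-reflexive (dist-sym z (y i)))
    separated (suc i) (suc j) i≢j = y-separated i j (i≢j ∘ ≡.cong suc)
    dist²≈0 : ∀ w → z ≋ w → dist² z w ≈ 0# * 0#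
    dist²≈0 w z≋w = trans
      (sum-cong-≋ {y = λ k → 0# * (z k * z k)} λ k → trans (*-cong (+-congʳ (z≋w k)) (+-congʳ (z≋w k)))
        (solve 2 (λ a b → (a :- a) :* (a :- a) := # 0 :* (b :* b)) (w k) (z k)))
      (trans (sym (*-distribˡ-sum 0# (λ k → z k * z k))) (trans (zeroˡ _) (sym (zeroˡ 0#))))

-- Counting separated points on a sphere near a given one.

module Packing (em : ExcludedMiddle 0ℓ) (ℝ : CompleteOrderedField) (d′ : ℕ) where

  open CompleteOrderedField ℝ
  open OrderedField em ℝ
  open Sums em ℝ
  open Analysis em ℝ
  open Geometry em ℝ (suc d′)
  open Metric em ℝ (suc d′)
  open import Relation.Binary.Reasoning.Setoid setoid

  module Grid (s : Carrier) where

    -- A floor function truncated at n: the last cell takes whatever lies beyond, which is why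
    -- `cell-close` assumes upper bounds.
    cell : ∀ n → Carrier → Carrier → Fin (suc n)
    cell zero    a x = zero
    cell (suc n) a x with em {x ≤ a + s}
    ... | yes _ = zero
    ... | no  _ = suc (cell n (a + s) x)

    -- Both factors of s² - (x - y)² = (s - (x - y))(s + (x - y)) are sums of two nonnegative gaps.
    difference² : ∀ {a x y} → a ≤ x → a ≤ y → x ≤ a + s → y ≤ a + s → (x - y) * (x - y) ≤ s * s
    difference² {a} {x} {y} a≤x a≤y x≤a+s y≤a+s =
      ≤-by (*-nonNeg (+-nonNeg (≤⇒0≤ a≤y) (≤⇒0≤ x≤a+s)) (+-nonNeg (≤⇒0≤ a≤x) (≤⇒0≤ y≤a+s)))
        (solve 4 (λ a s x y → s :* s := (x :- y) :* (x :- y) :+ (y :- a :+ (a :+ s :- x)) :* (x :- a :+ (a :+ s :- y))) a s x y)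

    cell-close : ∀ n {a x y} → a ≤ x → a ≤ y → x ≤ a + fromℕ (suc n) * s → y ≤ a + fromℕ (suc n) * s →
                 cell n a x ≡ cell n a y → (x - y) * (x - y) ≤ s * s
    cell-close zero {a} a≤x a≤y x≤ y≤ _ = difference² a≤x a≤y
      (≤-trans x≤ (≤-reflexive one)) (≤-trans y≤ (≤-reflexive one))
      where
      one : a + fromℕ 1 * s ≈ a + s
      one = solve 2 (λ a s → a :+ # 1 :* s := a :+ s) a s
    cell-close (suc n) {a} {x} {y} a≤x a≤y x≤ y≤ same with em {x ≤ a + s} | em {y ≤ a + s}
    ... | yes x≤a+s | yes y≤a+s = difference² a≤x a≤y x≤a+s y≤a+s
    ... | no  x≰a+s | no  y≰a+s = cell-close n (≰⇒≥ x≰a+s) (≰⇒≥ y≰a+s)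
      (≤-trans x≤ (≤-reflexive shift)) (≤-trans y≤ (≤-reflexive shift)) (Fin.suc-injective same)
      where
      shift : a + fromℕ (suc (suc n)) * s ≈ a + s + fromℕ (suc n) * s
      shift = solve 3 (λ a s k → a :+ (:1 :+ k) :* s := a :+ s :+ k :* s) a s (fromℕ (suc n))

  -- P is the constant of sum-square-bound for the d′ coordinates other than k.
  D P : Carrier
  D = fromℕ (suc d′)
  P = fromℕ 4 ^ d′

  0≤D : 0# ≤ D
  0≤D = 0≤fromℕ (suc d′)

  0≤P : 0# ≤ P
  0≤P = ^-nonNeg d′ (0≤fromℕ 4)

  ∥∥²≈ρ² : ∀ {ρ p} → Sphere ρ p → ∥ p ∥² ≈ ρ * ρ
  ∥∥²≈ρ² {p = p} p∈S = trans (sym (norm²≈∥∥² p)) (*-cong p∈S p∈S)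

  -- Otherwise summing (D p_k)² ≤ ρ² over the D coordinates gives D²ρ² ≤ Dρ², impossible for D > 1.
  -- Squares avoid a choice of sign.
  large-coordinate : ∀ {ρ p} → 0# < fromℕ d′ → 0# < ρ → Sphere ρ p → ∃[ k ] ρ * ρ ≤ (D * p k) * (D * p k)
  large-coordinate {ρ} {p} 0<d′ 0<ρ p∈S with em {∃[ k ] ρ * ρ ≤ (D * p k) * (D * p k)}
  ... | yes found = found
  ... | no  ¬∃   = ⊥-elim $ <⇒≱
    (<-by (*-pos 0<d′ (*-pos (0<fromℕ d′) (*-pos 0<ρ 0<ρ)))
          (solve 2 (λ k q → (:1 :+ k) :* (:1 :+ k) :* q := (:1 :+ k) :* q :+ k :* ((:1 :+ k) :* q)) (fromℕ d′) (ρ * ρ)))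
    (≤-resp (trans (sym (*-distribˡ-sum (D * D) (λ k → p k * p k))) (*-congˡ (∥∥²≈ρ² {p = p} p∈S))) refl
      (sum-bound λ k → ≤-resp (solve 2 (λ D x → (D :* x) :* (D :* x) := D :* D :* (x :* x)) D (p k)) refl
        (≰⇒≥ λ ρ²≤ → ¬∃ (k , ρ²≤))))

  -- The sphere near p as a Lipschitz graph over the coordinates other than k.

  module _ {ρ τ σ : Carrier} {p u v : Point} {k : Fin (suc d′)}
           (0<ρ : 0# < ρ) (0≤σ : 0# ≤ σ) (u∈S : Sphere ρ u) (v∈S : Sphere ρ v)
           (ρ²≤D²pₖ² : ρ * ρ ≤ (D * p k) * (D * p k)) (4D²τ≤ρ² : fromℕ 4 * (D * D * τ) ≤ ρ * ρ)
           (pu²≤τ : (p k - u k) * (p k - u k) ≤ τ) (pv²≤τ : (p k - v k) * (p k - v k) ≤ τ)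
           (uv²≤σ : ∀ l → (u (punchIn k l) - v (punchIn k l)) * (u (punchIn k l) - v (punchIn k l)) ≤ σ)
           where

    private
      w t : Carrier
      w = u k - v k
      t = u k + v k

      -- The coordinate shares of |u|² - |v|² = 0, in the shape of `sum-linear`. The share of
      -- coordinate k is w t.
      f : Vector Carrier (suc d′)
      f l = 1# * (u l * u l) + - 1# * (v l * v l)

    -- In t = 2p_k - (p_k - u_k) - (p_k - v_k) the first term has size at least 2ρ/D and each of the
    -- others at most ρ/(2D). The certificate uses the parallelogram law twice.
    ρ²≤D²t² : ρ * ρ ≤ D * D * (t * t)
    ρ²≤D²t² = *-cancelˡ-≤ (fromℕ 2) (0<fromℕ 1) $
      ≤-by (+-nonNeg (*-nonNeg (0≤fromℕ 4) (≤⇒0≤ ρ²≤D²pₖ²)) (+-nonNeg (*-nonNeg (0≤fromℕ 2) (≤⇒0≤ 4D²τ≤ρ²))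
             (*-nonNeg (0≤x² D) (+-nonNeg (0≤x² (t - (p k - u k + (p k - v k)))) (+-nonNeg (*-nonNeg (0≤fromℕ 2) (0≤x² w))
               (*-nonNeg (0≤fromℕ 4) (+-nonNeg (≤⇒0≤ pu²≤τ) (≤⇒0≤ pv²≤τ))))))))
        (solve 6 (λ ρ D τ p u v →
            # 2 :* (D :* D :* ((u :+ v) :* (u :+ v))) := # 2 :* (ρ :* ρ) :+
              (# 4 :* ((D :* p) :* (D :* p) :- ρ :* ρ) :+ (# 2 :* (ρ :* ρ :- # 4 :* (D :* D :* τ)) :+
                D :* D :* ((u :+ v :- (p :- u :+ (p :- v))) :* (u :+ v :- (p :- u :+ (p :- v))) :+
                  (# 2 :* ((u :- v) :* (u :- v)) :+ # 4 :* ((τ :- (p :- u) :* (p :- u)) :+ (τ :- (p :- v) :* (p :- v))))))))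
          ρ D τ (p k) (u k) (v k))

    Σf≈0 : sum f ≈ 0#
    Σf≈0 = begin
      sum f                             ≈⟨ sum-linear 1# (- 1#) (λ l → u l * u l) (λ l → v l * v l) ⟩
      1# * ∥ u ∥² + - 1# * ∥ v ∥²       ≈⟨ +-cong (*-congˡ (∥∥²≈ρ² {p = u} u∈S)) (*-congˡ (∥∥²≈ρ² {p = v} v∈S)) ⟩
      1# * (ρ * ρ) + - 1# * (ρ * ρ)     ≈⟨ solve 1 (λ q → :1 :* q :+ :- :1 :* q := # 0) (ρ * ρ) ⟩
      0#                                ∎

    -- A share factors as (u - v)(u + v), where (u - v)² ≤ σ and (u + v)² ≤ 4ρ² because single
    -- coordinates are bounded by ρ.
    f²≤ : ∀ l → f (punchIn k l) * f (punchIn k l) ≤ σ * (fromℕ 4 * (ρ * ρ))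
    f²≤ l = ≤-resp
      (solve 2 (λ u v → (u :- v) :* (u :- v) :* ((u :+ v) :* (u :+ v)) :=
         (:1 :* (u :* u) :+ :- :1 :* (v :* v)) :* (:1 :* (u :* u) :+ :- :1 :* (v :* v))) uₗ vₗ)
      refl
      (*-mono-≤ (0≤x² (uₗ - vₗ)) (0≤x² (uₗ + vₗ)) (uv²≤σ l)
        (≤-by (+-nonNeg (0≤x² (uₗ - vₗ)) (*-nonNeg (0≤fromℕ 2) (+-nonNeg (≤⇒0≤ (coordinate² {u} u∈S)) (≤⇒0≤ (coordinate² {v} v∈S)))))
          (solve 3 (λ u v q → # 4 :* q := (u :+ v) :* (u :+ v) :+ ((u :- v) :* (u :- v) :+ # 2 :* ((q :- u :* u) :+ (q :- v :* v))))
             uₗ vₗ (ρ * ρ))))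
      where
      uₗ vₗ : Carrier
      uₗ = u (punchIn k l)
      vₗ = v (punchIn k l)
      coordinate² : ∀ {x} → Sphere ρ x → x (punchIn k l) * x (punchIn k l) ≤ ρ * ρ
      coordinate² {x} x∈S = ≤-trans (term≤sum (λ i → 0≤x² (x i)) (punchIn k l)) (≤-reflexive (∥∥²≈ρ² {p = x} x∈S))

    -- The shares sum to 0, so w t = -S with S the sum of the others. Hence ρ²w² ≤ D²t²w² = D²S² ≤
    -- D²P · 4σρ², and ρ² cancels.
    last-coordinate : w * w ≤ fromℕ 4 * P * (D * D) * σ
    last-coordinate = *-cancelˡ-≤ (ρ * ρ) (*-pos 0<ρ 0<ρ) $
      ≤-by (+-nonNeg (*-nonNeg (0≤x² w) (≤⇒0≤ ρ²≤D²t²)) (*-nonNeg (0≤x² D) (≤⇒0≤ wt²≤)))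
        (solve 6 (λ ρ² D w t P σ → ρ² :* (# 4 :* P :* (D :* D) :* σ) := ρ² :* (w :* w) :+
             (w :* w :* (D :* D :* (t :* t) :- ρ²) :+ D :* D :* (P :* (σ :* (# 4 :* ρ²)) :- w :* t :* (w :* t))))
           (ρ * ρ) D w t P σ)
      where
      S : Carrier
      S = sum (Vector.removeAt f k)
      fₖ+S≈0 : f k + S ≈ 0#
      fₖ+S≈0 = trans (sym (sum-remove f)) Σf≈0
      wt²≤ : w * t * (w * t) ≤ P * (σ * (fromℕ 4 * (ρ * ρ)))
      wt²≤ = ≤-resp
        (begin
          S * S                                 ≈⟨ solve 2 (λ S F → S :* S := F :* F :+ (S :- F) :* (F :+ S)) S (f k) ⟩
          f k * f k + (S - f k) * (f k + S)     ≈⟨ +-congˡ (*-congˡ fₖ+S≈0) ⟩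
          f k * f k + (S - f k) * 0#            ≈⟨ solve 3 (λ u v y → let F = :1 :* (u :* u) :+ :- :1 :* (v :* v) ; wt = (u :- v) :* (u :+ v) in
                                                     F :* F :+ y :* # 0 := wt :* wt) (u k) (v k) (S - f k) ⟩
          w * t * (w * t)                       ∎)
        refl
        (sum-square-bound (Vector.removeAt f k) (*-nonNeg 0≤σ (*-nonNeg (0≤fromℕ 4) (0≤x² ρ))) f²≤)

    close-points : dist² u v ≤ D * ((1# + fromℕ 4 * P * (D * D)) * σ)
    close-points = sum-bound bound
      where
      c : Carrier
      c = fromℕ 4 * P * (D * D)
      0≤c : 0# ≤ c
      0≤c = *-nonNeg (*-nonNeg (0≤fromℕ 4) 0≤P) (0≤x² D)
      bound : ∀ l → (u l - v l) * (u l - v l) ≤ (1# + c) * σ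
      bound l with k Fin.≟ l
      ... | yes ≡.refl = ≤-trans last-coordinate (≤-by 0≤σ (solve 2 (λ c σ → (:1 :+ c) :* σ := c :* σ :+ σ) c σ))
      ... | no  k≢l    = ≤-trans
        (≡.subst (λ l → (u l - v l) * (u l - v l) ≤ σ) (Fin.punchIn-punchOut k≢l) (uv²≤σ (punchOut k≢l)))
        (≤-by (*-nonNeg 0≤c 0≤σ) (solve 2 (λ c σ → (:1 :+ c) :* σ := σ :+ c :* σ) c σ))

  -- From adjacency to distance, and from distance to degree.

  module _ {R r ρ c₁ Q : Carrier} {m : ℕ} {y : Vector Point m}
           (0≤r : 0# ≤ r) (0<ρ : 0# < ρ) (0<c₁ : 0# < c₁)
           (R²-ρ²≤Q : R * R - ρ * ρ ≤ Q) (ρ²-r²≤Q : ρ * ρ - r * r ≤ Q) (c₁²≤Q : c₁ * c₁ ≤ Q)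
           (y-maximal : IsMaximalSystem ρ (fromℕ 2 * c₁) y) where

    -- (s - ρ)² ≤ |s² - ρ²| for nonnegative s and ρ; below ρ the inner radius bounds the difference,
    -- above ρ the outer one.
    radial-distance : ∀ {s} → 0# ≤ s → s ≤ R → r ≤ s → (s - ρ) * (s - ρ) ≤ Q
    radial-distance {s} 0≤s s≤R r≤s with ≤-total s ρ
    ... | inj₁ s≤ρ = ≤-by
      (+-nonNeg (*-nonNeg (*-nonNeg (0≤fromℕ 2) 0≤s) (≤⇒0≤ s≤ρ)) (+-nonNeg (≤⇒0≤ (square-mono-≤ 0≤r r≤s)) (≤⇒0≤ ρ²-r²≤Q)))
      (solve 4 (λ s ρ r Q → Q := (s :- ρ) :* (s :- ρ) :+
         (# 2 :* s :* (ρ :- s) :+ ((s :* s :- r :* r) :+ (Q :- (ρ :* ρ :- r :* r))))) s ρ r Q)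
    ... | inj₂ ρ≤s = ≤-by
      (+-nonNeg (*-nonNeg (*-nonNeg (0≤fromℕ 2) (<⇒≤ 0<ρ)) (≤⇒0≤ ρ≤s)) (+-nonNeg (≤⇒0≤ (square-mono-≤ 0≤s s≤R)) (≤⇒0≤ R²-ρ²≤Q)))
      (solve 4 (λ s ρ R Q → Q := (s :- ρ) :* (s :- ρ) :+
         (# 2 :* ρ :* (s :- ρ) :+ ((R :* R :- s :* s) :+ (Q :- (R :* R :- ρ :* ρ))))) s ρ R Q)

    -- In the Voronoi region of y_i, y_i is no farther than the y_j near the radial projection z of
    -- a. The constant is 2Q + 2(2c₁)² ≤ 10Q.
    cell-radius : ∀ {i a} → Cell R r y i a → dist² a (y i) ≤ fromℕ 10 * Q
    cell-radius {i} {a} (a∈V , na≤R , na≰r) =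
      let r<na = ≰⇒> na≰r
          z , z∈S , az≈ = radial-projection a (≤-<-trans 0≤r r<na) (<⇒≤ 0<ρ)
          j , zyⱼ< = maximal⇒covering (*-pos (0<fromℕ 1) 0<c₁) y-maximal z z∈S
          az≤ = ≤-trans (≤-reflexive az≈) (radial-distance (0≤norm a) na≤R (<⇒≤ r<na))
      in ≤-trans (dist≤dist⇒dist²≤dist² {a} {y i} {a} {y j} (a∈V j)) $ ≤-trans (dist²-triangle a z (y j)) $
         ≤-by (+-nonNeg (*-nonNeg (0≤fromℕ 2) (≤⇒0≤ az≤))
                (+-nonNeg (*-nonNeg (0≤fromℕ 2) (≤⇒0≤ (dist≤⇒dist²≤ {z} {y j} (<⇒≤ zyⱼ<)))) (*-nonNeg (0≤fromℕ 8) (≤⇒0≤ c₁²≤Q))))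
           (solve 4 (λ Q A B c → # 10 :* Q := # 2 :* A :+ # 2 :* B :+
                (# 2 :* (Q :- A) :+ (# 2 :* ((# 2 :* c) :* (# 2 :* c) :- B) :+ # 8 :* (Q :- c :* c))))
              Q (dist² a z) (dist² z (y j)) c₁)

    -- Since R² - r² ≤ 2Q, the constant is 2 · 10 + 2 · 8 = 36.
    half-path : ∀ {i a b} → Cell R r y i a → dist² a b ≤ fromℕ 4 * (R * R - r * r) → dist² (y i) b ≤ fromℕ 36 * Q
    half-path {i} {a} {b} a∈W ab≤ = ≤-trans (dist²-triangle (y i) a b) $
      ≤-by (+-nonNeg (*-nonNeg (0≤fromℕ 2) (≤⇒0≤ (≤-resp (dist²-sym a (y i)) refl (cell-radius {i} {a} a∈W))))
             (+-nonNeg (*-nonNeg (0≤fromℕ 2) (≤⇒0≤ ab≤)) (*-nonNeg (0≤fromℕ 8) (+-nonNeg (≤⇒0≤ R²-ρ²≤Q) (≤⇒0≤ ρ²-r²≤Q)))))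
        (solve 6 (λ Q A B R r ρ → # 36 :* Q := # 2 :* A :+ # 2 :* B :+
             (# 2 :* (# 10 :* Q :- A) :+ (# 2 :* (# 4 :* (R :- r) :- B) :+ # 8 :* ((Q :- (R :- ρ)) :+ (Q :- (ρ :- r))))))
           Q (dist² (y i) a) (dist² a b) (R * R) (r * r) (ρ * ρ))

    -- The two half-paths meet at b: 2 · 36 + 2 · 36 = 144.
    adjacent⇒dist²≤ : ∀ {i j} → Adjacent R r y i j → dist² (y i) (y j) ≤ fromℕ 144 * Q
    adjacent⇒dist²≤ {i} {j} (_ , a , a′ , b , a∈Wᵢ@(_ , na≤R , _) , a′∈Wⱼ@(_ , na′≤R , _) , (nb≤R , _) , [a,b]⊆A , [b,a′]⊆A) =
      ≤-trans (dist²-triangle (y i) b (y j)) $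
      ≤-by (+-nonNeg (*-nonNeg (0≤fromℕ 2) (≤⇒0≤ (half-path {i} {a} {b} a∈Wᵢ (visible⇒dist²≤ {a = a} {b} 0≤r na≤R nb≤R [a,b]⊆A))))
             (*-nonNeg (0≤fromℕ 2) (≤⇒0≤ (≤-resp (dist²-sym (y j) b) refl
               (half-path {j} {a′} {b} a′∈Wⱼ (≤-resp (dist²-sym b a′) refl (visible⇒dist²≤ {a = b} {a′} 0≤r nb≤R na′≤R [b,a′]⊆A)))))))
        (solve 3 (λ Q A B → # 144 :* Q := # 2 :* A :+ # 2 :* B :+ (# 2 :* (# 36 :* Q :- A) :+ # 2 :* (# 36 :* Q :- B)))
           Q (dist² (y i) b) (dist² b (y j)))

    module _ {T s : Carrier} {n : ℕ} (0<d′ : 0# < fromℕ d′) (0≤T : 0# ≤ T)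
             (144Q≤T² : fromℕ 144 * Q ≤ T * T) (4D²T²≤ρ² : fromℕ 4 * (D * D * (T * T)) ≤ ρ * ρ)
             (2T≤ns : fromℕ 2 * T ≤ fromℕ (suc n) * s)
             (s-small : D * ((1# + fromℕ 4 * P * (D * D)) * (s * s)) ≤ c₁ * c₁) where

      open Grid s

      -- A neighbour is coded by its grid cell in the d′ coordinates other than k. Two different
      -- neighbours with one code would satisfy 4c₁² ≤ |y_j - y_j′|² ≤ c₁².
      degree≤ : ∀ i → degree R r y i ℕ.≤ suc n ℕ.^ d′
      degree≤ i = Counting.length-filter≤ (λ j → em {Adjacent R r y i j}) code code-injective
        where
        y∈S : ∀ j → Sphere ρ (y j)
        y∈S = proj₁ (proj₁ y-maximal)
        k : Fin (suc d′)
        k = proj₁ (large-coordinate {p = y i} 0<d′ 0<ρ (y∈S i))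
        coordinates : ∀ j → Fin d′ → Fin (suc n)
        -- The grid starts at the least value a neighbour can take; `2T≤ns` lets its n + 1 intervals
        -- cover the whole range of length 2T.
        coordinates j l = cell n (y i (punchIn k l) - T) (y j (punchIn k l))
        code : ∀ j → Fin (suc n ℕ.^ d′)
        code j = funToFin (coordinates j)
        near : ∀ {j} → Adjacent R r y i j → ∀ l → (y i l - y j l) * (y i l - y j l) ≤ T * T
        near {j} i∼j l = ≤-trans (coordinate≤dist² (y i) (y j) l) (≤-trans (adjacent⇒dist²≤ i∼j) 144Q≤T²)
        lower : ∀ {j} → Adjacent R r y i j → ∀ l → y i l - T ≤ y j l
        lower {j} i∼j l = ≤-by (≤⇒0≤ (square-cancel-≤ 0≤T (near i∼j l)))
          (solve 3 (λ p u T → u := p :- T :+ (T :- (p :- u))) (y i l) (y j l) T)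
        upper : ∀ {j} → Adjacent R r y i j → ∀ l → y j l ≤ y i l - T + fromℕ (suc n) * s
        upper {j} i∼j l = ≤-by
          (+-nonNeg
            (≤⇒0≤ (square-cancel-≤ 0≤T (≤-resp (solve 2 (λ p u → (p :- u) :* (p :- u) := (u :- p) :* (u :- p)) (y i l) (y j l)) refl (near i∼j l))))
            (≤⇒0≤ 2T≤ns))
          (solve 4 (λ p u T q → p :- T :+ q := u :+ ((T :- (u :- p)) :+ (q :- # 2 :* T))) (y i l) (y j l) T (fromℕ (suc n) * s))
        code-injective : ∀ j j′ → Adjacent R r y i j → Adjacent R r y i j′ → code j ≡ code j′ → j ≡ j′
        code-injective j j′ i∼j i∼j′ same with j Fin.≟ j′
        ... | yes j≡j′ = j≡j′
        ... | no  j≢j′ = ⊥-elim $ <⇒≱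
          (<-by (*-pos (0<fromℕ 2) (*-pos 0<c₁ 0<c₁))
                (solve 1 (λ c → (# 2 :* c) :* (# 2 :* c) := c :* c :+ # 3 :* (c :* c)) c₁))
          (≤-trans (≤dist⇒≤dist² {x = y j} {y = y j′} (*-nonNeg (0≤fromℕ 2) (<⇒≤ 0<c₁)) (proj₂ (proj₁ y-maximal) j j′ j≢j′))
            (≤-trans (close-points {p = y i} {u = y j} {v = y j′} {k = k} 0<ρ (0≤x² s) (y∈S j) (y∈S j′) (proj₂ (large-coordinate {p = y i} 0<d′ 0<ρ (y∈S i))) 4D²T²≤ρ²
                        (near i∼j k) (near i∼j′ k) λ l →
                        cell-close n (lower i∼j (punchIn k l)) (lower i∼j′ (punchIn k l)) (upper i∼j (punchIn k l)) (upper i∼j′ (punchIn k l))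
                          (≡.trans (≡.sym (Fin.finToFun-funToFin (coordinates j) l))
                            (≡.trans (≡.cong (λ e → finToFun e l) same) (Fin.finToFun-funToFin (coordinates j′) l))))
              s-small))

      maxDegree≤ : maxDegree R r y ℕ.≤ suc n ℕ.^ d′
      maxDegree≤ = Counting.foldr-⊔≤ (degree R r y) degree≤

-- Asymptotic estimates for the three radii.

module RadiiBounds (em : ExcludedMiddle 0ℓ) (ℝ : CompleteOrderedField) where

  open CompleteOrderedField ℝ
  open OrderedField em ℝ
  open Analysis em ℝ
  open Exponential em ℝ
  open Radii em ℝ
  open import Relation.Binary.Reasoning.Setoid setoid

  module Bounds (c₀ c c₁ M : Carrier) (0<c : 0# < c) (5c₁²+1≤M : fromℕ 5 * (c₁ * c₁) + 1# ≤ M) where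

    -- a₀ bounds |c₀| without an absolute value. B collects the multiples of log log n that log n
    -- must dominate, and Λ is a size of log log n that suffices for this.
    a₀ B Λ : Carrier
    a₀ = c₀ * c₀ + 1#
    B  = M + 1# + fromℕ 2 * c + a₀
    Λ  = fromℕ 4 * B + 1#

    c₀≤a₀ : c₀ ≤ a₀
    c₀≤a₀ = *-cancelˡ-≤ (fromℕ 2) (0<fromℕ 1) $
      ≤-by (+-nonNeg (0≤x² (c₀ - 1#)) (+-nonNeg (0≤x² c₀) (<⇒≤ 0<1)))
        (solve 1 (λ x → # 2 :* (x :* x :+ :1) := # 2 :* x :+ ((x :- :1) :* (x :- :1) :+ (x :* x :+ :1))) c₀)

    -c₀≤a₀ : - c₀ ≤ a₀
    -c₀≤a₀ = *-cancelˡ-≤ (fromℕ 2) (0<fromℕ 1) $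
      ≤-by (+-nonNeg (0≤x² (c₀ + 1#)) (+-nonNeg (0≤x² c₀) (<⇒≤ 0<1)))
        (solve 1 (λ x → # 2 :* (x :* x :+ :1) := # 2 :* (:- x) :+ ((x :+ :1) :* (x :+ :1) :+ (x :* x :+ :1))) c₀)

    0≤a₀ : 0# ≤ a₀
    0≤a₀ = +-nonNeg (0≤x² c₀) (<⇒≤ 0<1)

    0≤2c : 0# ≤ fromℕ 2 * c
    0≤2c = *-nonNeg (0≤fromℕ 2) (<⇒≤ 0<c)

    1≤M : 1# ≤ M
    1≤M = ≤-trans (≤-by (*-nonNeg (0≤fromℕ 5) (0≤x² c₁)) (+-comm _ 1#)) 5c₁²+1≤M

    5c₁²≤M : fromℕ 5 * (c₁ * c₁) ≤ M
    5c₁²≤M = ≤-trans (≤-by (<⇒≤ 0<1) refl) 5c₁²+1≤M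

    0≤M : 0# ≤ M
    0≤M = ≤-trans (<⇒≤ 0<1) 1≤M

    0≤B : 0# ≤ B
    0≤B = +-nonNeg (+-nonNeg (+-nonNeg 0≤M (<⇒≤ 0<1)) 0≤2c) 0≤a₀

    1≤Λ : 1# ≤ Λ
    1≤Λ = ≤-by (*-nonNeg (0≤fromℕ 4) 0≤B) (+-comm _ 1#)

    -- With x = 2h: 4bx ≤ x² = 4h² ≤ 4(exp h)² = 4 exp x.
    linear≤exp : ∀ {b x} → 0# ≤ x → fromℕ 4 * b ≤ x → b * x ≤ exp x
    linear≤exp {b} {x} 0≤x 4b≤x = *-cancelˡ-≤ (fromℕ 4) (0<fromℕ 3) $
      ≤-trans (≤-by (*-nonNeg (≤⇒0≤ 4b≤x) 0≤x) (solve 2 (λ b x → x :* x := # 4 :* (b :* x) :+ (x :- # 4 :* b) :* x) b x)) $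
      ≤-resp
        (trans (solve 1 (λ h → # 4 :* (h :* h) := (h :+ h) :* (h :+ h)) h) (*-cong (sym (x≈½x+½x x)) (sym (x≈½x+½x x))))
        (*-congˡ (trans (sym (exp-+ h h)) (exp-cong (sym (x≈½x+½x x)))))
        (*-monoˡ-≤ (fromℕ 4) (0≤fromℕ 4) (square-mono-≤ 0≤h (≤-trans (≤-by (<⇒≤ 0<1) (+-comm 1# h)) (1+x≤exp h))))
      where
      h : Carrier
      h = x / fromℕ 2
      0≤h : 0# ≤ h
      0≤h = *-nonNeg 0≤x (<⇒≤ (0<x⁻¹ (0<fromℕ 1)))

    module _ {n : ℕ} (0<L : 0# < logℕ n) (Λ≤LL : Λ ≤ loglogℕ n) where

      private
        L LL W ρ R r : Carrier
        L  = logℕ n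
        LL = loglogℕ n
        W  = log (((c * LL) ^ 2) ⁻¹)
        ρ  = sphereRadius c n
        R  = outerRadius c₀ n
        r  = innerRadius c c₁ n

      1≤LL : 1# ≤ LL
      1≤LL = ≤-trans 1≤Λ Λ≤LL

      0≤LL : 0# ≤ LL
      0≤LL = ≤-trans (<⇒≤ 0<1) 1≤LL

      B*LL≤L : B * LL ≤ L
      B*LL≤L = ≤-resp refl (exp-log 0<L) (linear≤exp 0≤LL (≤-trans (≤-by (<⇒≤ 0<1) refl) Λ≤LL))

      -- W is -2 log q with q = c log log n, and log q ≤ q.
      -2cLL≤W : - (fromℕ 2 * c * LL) ≤ W
      -2cLL≤W = ≤-by (+-nonNeg (≤⇒0≤ w≤q) (≤⇒0≤ w≤q))
        (trans (log-unique exp≈) (solve 3 (λ c l w → :- (w :+ w) := :- (# 2 :* c :* l) :+ ((c :* l :- w) :+ (c :* l :- w))) c LL w))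
        where
        q w : Carrier
        q = c * LL
        w = log q
        0<q : 0# < q
        0<q = *-pos 0<c (<-≤-trans 0<1 1≤LL)
        ew≈q : exp w ≈ q
        ew≈q = exp-log 0<q
        w≤q : w ≤ q
        w≤q = ≤-trans (≤-by (<⇒≤ 0<1) (+-comm 1# w)) (≤-trans (1+x≤exp w) (≤-reflexive ew≈q))
        exp≈ : exp (- (w + w)) ≈ (q ^ 2) ⁻¹
        exp≈ = begin
          e                              ≈⟨ *-identityʳ e ⟨
          e * 1#                         ≈⟨ *-congˡ (x*x⁻¹≈1 (^-pos 2 0<q)) ⟨
          e * (q ^ 2 * (q ^ 2) ⁻¹)       ≈⟨ solve 3 (λ e q i → e :* (q :^ 2 :* i) := q :* q :* e :* i) e q ((q ^ 2) ⁻¹) ⟩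
          q * q * e * (q ^ 2) ⁻¹         ≈⟨ *-congʳ (*-congʳ (trans (exp-+ w w) (*-cong ew≈q ew≈q))) ⟨
          exp (w + w) * e * (q ^ 2) ⁻¹   ≈⟨ *-congʳ (exp*exp⁻≈1 (w + w)) ⟩
          1# * (q ^ 2) ⁻¹                ≈⟨ *-identityˡ _ ⟩
          (q ^ 2) ⁻¹                     ∎
          where
          e : Carrier
          e = exp (- (w + w))

      -- One copy of log n absorbs all multiples of log log n. The bound also makes the radicand
      -- nonnegative, so that `sqrt` is a genuine root.
      M*LL≤ρ² : M * LL ≤ fromℕ 2 * L - LL + W
      M*LL≤ρ² = ≤-by
        (+-nonNeg (≤⇒0≤ B*LL≤L) (+-nonNeg (<⇒≤ 0<L) (+-nonNeg (≤⇒0≤ -2cLL≤W) (*-nonNeg 0≤a₀ 0≤LL))))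
        (solve 6 (λ M c a L l W → # 2 :* L :- l :+ W := M :* l :+
            ((L :- (M :+ :1 :+ # 2 :* c :+ a) :* l) :+ (L :+ ((W :- (:- (# 2 :* c :* l))) :+ a :* l))))
          M c a₀ L LL W)

      0≤ρ : 0# ≤ ρ
      0≤ρ = proj₁ (sqrt-spec _ (≤-trans (*-nonNeg 0≤M 0≤LL) M*LL≤ρ²))

      ρ²≈ : ρ * ρ ≈ fromℕ 2 * L - LL + W
      ρ²≈ = proj₂ (sqrt-spec _ (≤-trans (*-nonNeg 0≤M 0≤LL) M*LL≤ρ²))

      sphereRadius-lower : M * LL ≤ ρ * ρ
      sphereRadius-lower = ≤-trans M*LL≤ρ² (≤-reflexive (sym ρ²≈))

      M≤ρ² : M ≤ ρ * ρ
      M≤ρ² = ≤-trans (≤-by (*-nonNeg 0≤M (≤⇒0≤ 1≤LL)) (solve 2 (λ M l → M :* l := M :+ M :* (l :- :1)) M LL)) sphereRadius-lower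

      0<ρ : 0# < ρ
      0<ρ = *-pos⁻ 0≤ρ (<-≤-trans 0<1 (≤-trans 1≤M M≤ρ²))

      -- The terms 2 log n cancel, leaving c₀ LL + LL - W.
      R²-ρ²≤ : R * R - ρ * ρ ≤ (a₀ + 1# + fromℕ 2 * c) * LL
      R²-ρ²≤ = ≤-by (+-nonNeg (≤⇒0≤ -2cLL≤W) (*-nonNeg (≤⇒0≤ c₀≤a₀) 0≤LL))
        (begin
          (a₀ + 1# + fromℕ 2 * c) * LL
            ≈⟨ solve 6 (λ a c c₀ L l W → (a :+ :1 :+ # 2 :* c) :* l :=
                 (# 2 :* L :+ c₀ :* l :- (# 2 :* L :- l :+ W)) :+ ((W :- (:- (# 2 :* c :* l))) :+ (a :- c₀) :* l)) a₀ c c₀ L LL W ⟩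
          (fromℕ 2 * L + c₀ * LL - (fromℕ 2 * L - LL + W)) + ((W - - (fromℕ 2 * c * LL)) + (a₀ - c₀) * LL)
            ≈⟨ +-congʳ (+-cong R²≈ (-‿cong ρ²≈)) ⟨
          R * R - ρ * ρ + ((W - - (fromℕ 2 * c * LL)) + (a₀ - c₀) * LL) ∎)
        where
        log-power : log (L ** c₀) ≈ c₀ * LL
        log-power = log-unique refl
        -- Here c₀ may be negative, so log n has to dominate |c₀| log log n.
        0≤2L+c₀LL : 0# ≤ fromℕ 2 * L + log (L ** c₀)
        0≤2L+c₀LL = ≤-trans
          (+-nonNeg (<⇒≤ 0<L) (+-nonNeg (≤⇒0≤ B*LL≤L) (*-nonNeg (+-nonNeg (+-nonNeg (+-nonNeg 0≤M (<⇒≤ 0<1)) 0≤2c) (≤⇒0≤ -c₀≤a₀)) 0≤LL)))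
          (≤-reflexive (trans
            (solve 6 (λ M c a c₀ L l → L :+ ((L :- (M :+ :1 :+ # 2 :* c :+ a) :* l) :+ (M :+ :1 :+ # 2 :* c :+ (a :- (:- c₀))) :* l) :=
               # 2 :* L :+ c₀ :* l) M c a₀ c₀ L LL)
            (+-congˡ (sym log-power))))
        R²≈ : R * R ≈ fromℕ 2 * L + c₀ * LL
        R²≈ = trans (proj₂ (sqrt-spec _ 0≤2L+c₀LL)) (+-congˡ log-power)

      private
        q : Carrier
        q = fromℕ 5 * c₁ ^ 2 / ρ
        qρ≈5c₁² : q * ρ ≈ fromℕ 5 * c₁ ^ 2
        qρ≈5c₁² = [x/y]*y≈x _ 0<ρ

      -- The subtracted q = 5c₁²/ρ is at most ρ because 5c₁² ≤ M ≤ ρ².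
      0≤r : 0# ≤ r
      0≤r = ≤⇒0≤ (*-cancelˡ-≤ ρ 0<ρ (≤-resp
        (trans (solve 1 (λ c → # 5 :* (c :* c) := # 5 :* c :^ 2) c₁) (trans (sym qρ≈5c₁²) (*-comm q ρ))) refl
        (≤-trans 5c₁²≤M M≤ρ²)))

      -- With r = ρ - q the difference is 2qρ - q², and qρ = 5c₁².
      ρ²-r²≤ : ρ * ρ - r * r ≤ fromℕ 10 * (c₁ * c₁)
      ρ²-r²≤ = ≤-by (0≤x² q) (begin
        fromℕ 10 * (c₁ * c₁)                                          ≈⟨ solve 1 (λ c → # 10 :* (c :* c) := # 2 :* (# 5 :* c :^ 2)) c₁ ⟩
        fromℕ 2 * (fromℕ 5 * c₁ ^ 2)                                  ≈⟨ *-congˡ qρ≈5c₁² ⟨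
        fromℕ 2 * (q * ρ)                                             ≈⟨ solve 2 (λ q ρ → # 2 :* (q :* ρ) := ρ :* ρ :- (ρ :- q) :* (ρ :- q) :+ q :* q) q ρ ⟩
        ρ * ρ - r * r + q * q                                         ∎)

    eventually-large : ∃[ N ] (∀ n → N ℕ.≤ n → 0# < logℕ n × Λ ≤ loglogℕ n)
    eventually-large = let N , e≤N = archimedean (exp (exp Λ)) in N , λ n N≤n →
      let e≤n  = ≤-trans e≤N (fromℕ-mono N≤n)
          eΛ≤L = exp-cancel-≤ (≤-resp refl (sym (exp-log (<-≤-trans (0<exp (exp Λ)) e≤n))) e≤n)
          0<L  = <-≤-trans (0<exp Λ) eΛ≤L
      in 0<L , exp-cancel-≤ (≤-resp refl (sym (exp-log 0<L)) eΛ≤L)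

-- Constants independent of n, and the resulting degree bound.

module UniformDegreeBound (em : ExcludedMiddle 0ℓ) (ℝ : CompleteOrderedField) (d′ : ℕ) where

  open CompleteOrderedField ℝ
  open OrderedField em ℝ
  open Analysis em ℝ
  open Geometry em ℝ (suc d′)
  open Packing em ℝ d′
  open import Relation.Binary.Reasoning.Setoid setoid

  module Bound (a c₁ : Carrier) (0<d′ : 0# < fromℕ d′) (0≤a : 0# ≤ a) (0<c₁ : 0# < c₁) where

    -- With l = log log n and σ² = l: K l bounds the Q of maxDegree≤, T = κ σ satisfies 144 K l ≤ T²,
    -- M l ≤ ρ² ensures 4 D² T² ≤ ρ², and s² F ≤ (s E)² = c₁².
    K κ M F E s C : Carrier
    K = a + fromℕ 10 * (c₁ * c₁)
    κ = fromℕ 144 * K + 1#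
    M = fromℕ 5 * (c₁ * c₁) + 1# + fromℕ 4 * (D * D * (κ * κ))
    F = D * (1# + fromℕ 4 * P * (D * D))
    E = 1# + F
    s = c₁ / E
    C = fromℕ 2 * κ / s + fromℕ 2

    0≤c₁² : 0# ≤ c₁ * c₁
    0≤c₁² = 0≤x² c₁

    0≤K : 0# ≤ K
    0≤K = +-nonNeg 0≤a (*-nonNeg (0≤fromℕ 10) 0≤c₁²)

    0≤κ : 0# ≤ κ
    0≤κ = +-nonNeg (*-nonNeg (0≤fromℕ 144) 0≤K) (<⇒≤ 0<1)

    0≤F : 0# ≤ F
    0≤F = *-nonNeg 0≤D (+-nonNeg (<⇒≤ 0<1) (*-nonNeg (*-nonNeg (0≤fromℕ 4) 0≤P) (0≤x² D)))

    0<E : 0# < E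
    0<E = +-pos 0<1 0≤F

    0<s : 0# < s
    0<s = 0<x/y 0<c₁ 0<E

    5c₁²+1≤M : fromℕ 5 * (c₁ * c₁) + 1# ≤ M
    5c₁²+1≤M = ≤-by (*-nonNeg (0≤fromℕ 4) (*-nonNeg (0≤x² D) (0≤x² κ))) refl

    s-small : D * ((1# + fromℕ 4 * P * (D * D)) * (s * s)) ≤ c₁ * c₁
    s-small = ≤-by (*-nonNeg (+-nonNeg (<⇒≤ 0<1) (+-nonNeg 0≤F (0≤x² F))) (0≤x² s)) (begin
      c₁ * c₁               ≈⟨ *-cong ([x/y]*y≈x c₁ 0<E) ([x/y]*y≈x c₁ 0<E) ⟨
      s * E * (s * E)       ≈⟨ solve 3 (λ s D G → let F = D :* G in s :* (:1 :+ F) :* (s :* (:1 :+ F)) :=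
                                 D :* (G :* (s :* s)) :+ (:1 :+ (F :+ F :* F)) :* (s :* s)) s D (1# + fromℕ 4 * P * (D * D)) ⟩
      D * ((1# + fromℕ 4 * P * (D * D)) * (s * s)) + (1# + (F + F * F)) * (s * s) ∎)

    module _ {R r ρ l σ : Carrier} {m : ℕ} {y : Vector Point m}
             (0≤r : 0# ≤ r) (0<ρ : 0# < ρ) (1≤l : 1# ≤ l) (0≤σ : 0# ≤ σ) (σ²≈l : σ * σ ≈ l)
             (R²-ρ²≤al : R * R - ρ * ρ ≤ a * l) (ρ²-r²≤10c₁² : ρ * ρ - r * r ≤ fromℕ 10 * (c₁ * c₁)) (Ml≤ρ² : M * l ≤ ρ * ρ)
             (y-maximal : IsMaximalSystem ρ (fromℕ 2 * c₁) y) where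

      private
        T Q : Carrier
        T = κ * σ
        Q = K * l

      0≤l : 0# ≤ l
      0≤l = ≤-trans (<⇒≤ 0<1) 1≤l

      1≤σ : 1# ≤ σ
      1≤σ = square-cancel-≤ 0≤σ (≤-resp (sym (*-identityʳ 1#)) (sym σ²≈l) 1≤l)

      0≤T : 0# ≤ T
      0≤T = *-nonNeg 0≤κ 0≤σ

      T²≈κ²l : T * T ≈ κ * κ * l
      T²≈κ²l = trans (solve 2 (λ k s → k :* s :* (k :* s) := k :* k :* (s :* s)) κ σ) (*-congˡ σ²≈l)

      R²-ρ²≤Q : R * R - ρ * ρ ≤ Q
      R²-ρ²≤Q = ≤-trans R²-ρ²≤al (≤-by (*-nonNeg (*-nonNeg (0≤fromℕ 10) 0≤c₁²) 0≤l)
        (solve 3 (λ a b l → (a :+ b) :* l := a :* l :+ b :* l) a (fromℕ 10 * (c₁ * c₁)) l))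

      10c₁²≤Q : fromℕ 10 * (c₁ * c₁) ≤ Q
      10c₁²≤Q = ≤-by (+-nonNeg (*-nonNeg 0≤a 0≤l) (*-nonNeg (*-nonNeg (0≤fromℕ 10) 0≤c₁²) (≤⇒0≤ 1≤l)))
        (solve 3 (λ a b l → (a :+ b) :* l := b :+ (a :* l :+ b :* (l :- :1))) a (fromℕ 10 * (c₁ * c₁)) l)

      c₁²≤Q : c₁ * c₁ ≤ Q
      c₁²≤Q = ≤-trans (≤-by (*-nonNeg (0≤fromℕ 9) 0≤c₁²) (solve 1 (λ q → # 10 :* q := q :+ # 9 :* q) (c₁ * c₁))) 10c₁²≤Q

      -- κ = 144K + 1 is at least 1, so κ² ≥ 144K; this avoids a square root in T.
      144Q≤T² : fromℕ 144 * Q ≤ T * T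
      144Q≤T² = ≤-by (*-nonNeg (+-nonNeg (*-nonNeg 0≤144K 0≤κ) (<⇒≤ 0<1)) 0≤l)
        (trans T²≈κ²l (solve 3 (λ e k l → (e :* k :+ :1) :* (e :* k :+ :1) :* l := e :* (k :* l) :+ (e :* k :* (e :* k :+ :1) :+ :1) :* l)
          (fromℕ 144) K l))
        where
        0≤144K : 0# ≤ fromℕ 144 * K
        0≤144K = *-nonNeg (0≤fromℕ 144) 0≤K

      4D²T²≤ρ² : fromℕ 4 * (D * D * (T * T)) ≤ ρ * ρ
      4D²T²≤ρ² = ≤-trans
        (≤-resp (*-congˡ (*-congˡ (sym T²≈κ²l))) refl
          (≤-by (*-nonNeg (+-nonNeg (*-nonNeg (0≤fromℕ 5) 0≤c₁²) (<⇒≤ 0<1)) 0≤l)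
            (solve 4 (λ b D k l → (b :+ # 4 :* (D :* D :* k)) :* l := # 4 :* (D :* D :* (k :* l)) :+ b :* l)
              (fromℕ 5 * (c₁ * c₁) + 1#) D (κ * κ) l)))
        Ml≤ρ²

      maxDegree≤[Cσ]^d′ : fromℕ (maxDegree R r y) ≤ (C * σ) ^ d′
      maxDegree≤[Cσ]^d′ = let g , ratio≤g , g≤ratio+1 = ceiling (fromℕ 2 * T / s) 0≤ratio in
        ≤-trans
          (fromℕ-mono (maxDegree≤ {y = y} 0≤r 0<ρ 0<c₁ R²-ρ²≤Q (≤-trans ρ²-r²≤10c₁² 10c₁²≤Q) c₁²≤Q
            y-maximal {n = g} 0<d′ 0≤T 144Q≤T² 4D²T²≤ρ² (2T≤[1+g]s {g} ratio≤g) s-small)) $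
        ≤-trans (≤-reflexive (fromℕ-^ (suc g) d′)) $
        ^-mono-≤ d′ (0≤fromℕ (suc g)) (1+g≤Cσ {g} g≤ratio+1)
        where
        0≤ratio : 0# ≤ fromℕ 2 * T / s
        0≤ratio = *-nonNeg (*-nonNeg (0≤fromℕ 2) 0≤T) (<⇒≤ (0<x⁻¹ 0<s))
        2T≤[1+g]s : ∀ {g} → fromℕ 2 * T / s ≤ fromℕ g → fromℕ 2 * T ≤ fromℕ (suc g) * s
        2T≤[1+g]s {g} ratio≤g = ≤-resp ([x/y]*y≈x _ 0<s) refl (*-mono-≤ 0≤ratio (<⇒≤ 0<s)
          (≤-trans ratio≤g (≤-by (<⇒≤ 0<1) (+-comm 1# (fromℕ g)))) ≤-refl)
        -- The two units, from the ceiling and from the successor, are absorbed by the summand 2 of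
        -- C because σ ≥ 1.
        1+g≤Cσ : ∀ {g} → fromℕ g ≤ fromℕ 2 * T / s + 1# → fromℕ (suc g) ≤ C * σ
        1+g≤Cσ g≤ratio+1 = ≤-trans (+-monoʳ-≤ 1# g≤ratio+1)
          (≤-by (*-nonNeg (0≤fromℕ 2) (≤⇒0≤ 1≤σ))
            (solve 3 (λ k σ i → (# 2 :* k :* i :+ # 2) :* σ := :1 :+ (# 2 :* (k :* σ) :* i :+ :1) :+ # 2 :* (σ :- :1)) κ σ (s ⁻¹)))

-- The degree bound for the graph G.

theorem10p2 :
    (em : ExcludedMiddle 0ℓ) (ℝ : CompleteOrderedField) (d : ℕ) → 2 ℕ.≤ d →
    let open CompleteOrderedField ℝ
        open Analysis em ℝ
        open Geometry em ℝ d
        open Radii em ℝ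
    in
    (c₀ c c₁ : Carrier) → 0# < c → 0# < c₁ →
    ∃[ C ] ∃[ N ] (∀ n → N ℕ.≤ n →
      ∀ m (y : Vector Point m) →
      IsMaximalSystem (sphereRadius c n) (fromℕ 2 * c₁) y →
      fromℕ (maxDegree (outerRadius c₀ n) (innerRadius c c₁ n) y)
        ≤ C * loglogℕ n ** (fromℕ (d ℕ.∸ 1) / fromℕ 2))
-- The pattern exposes d′ = d - 1 as a successor; its positivity feeds `large-coordinate`.
theorem10p2 em ℝ (suc d′@(suc d″)) (ℕ.s≤s (ℕ.s≤s ℕ.z≤n)) c₀ c c₁ 0<c 0<c₁ = C ^ d′ , proj₁ eventually-large , bound
  where
  open CompleteOrderedField ℝ
  open Analysis em ℝ
  open Geometry em ℝ (suc d′)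
  open Radii em ℝ
  open OrderedField em ℝ
  open Exponential em ℝ

  0≤a : 0# ≤ c₀ * c₀ + 1# + 1# + fromℕ 2 * c
  0≤a = +-nonNeg (+-nonNeg (+-nonNeg (0≤x² c₀) (<⇒≤ 0<1)) (<⇒≤ 0<1)) (*-nonNeg (0≤fromℕ 2) (<⇒≤ 0<c))

  -- The coefficient passed here is that of `R²-ρ²≤` unfolded. It does not involve M, so M can be
  -- computed from it and then fix the threshold on n.
  open UniformDegreeBound.Bound em ℝ d′ (c₀ * c₀ + 1# + 1# + fromℕ 2 * c) c₁ (0<fromℕ d″) 0≤a 0<c₁ using (C; M; 5c₁²+1≤M; maxDegree≤[Cσ]^d′)
  open RadiiBounds.Bounds em ℝ c₀ c c₁ M 0<c 5c₁²+1≤M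

  bound : ∀ n → proj₁ eventually-large ℕ.≤ n → ∀ m (y : Vector Point m) →
          IsMaximalSystem (sphereRadius c n) (fromℕ 2 * c₁) y →
          fromℕ (maxDegree (outerRadius c₀ n) (innerRadius c c₁ n) y) ≤ C ^ d′ * loglogℕ n ** (fromℕ d′ / fromℕ 2)
  bound n N≤n m y y-maximal =
    -- σ is the square root of log log n, in the exponential form that `exp-½^` expects.
    let LL = loglogℕ n ; σ = exp (log LL / fromℕ 2)
        0<L , Λ≤LL = proj₂ eventually-large n N≤n
        0<LL = <-≤-trans 0<1 (1≤LL {n} 0<L Λ≤LL)
    in ≤-trans
      (maxDegree≤[Cσ]^d′ {R = outerRadius c₀ n} {r = innerRadius c c₁ n} {ρ = sphereRadius c n} {l = LL} {σ = σ} {y = y}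
        (0≤r {n} 0<L Λ≤LL) (0<ρ {n} 0<L Λ≤LL) (1≤LL {n} 0<L Λ≤LL) (<⇒≤ (0<exp (log LL / fromℕ 2)))
        (trans (exp-½² (log LL)) (exp-log 0<LL)) (R²-ρ²≤ {n} 0<L Λ≤LL) (ρ²-r²≤ {n} 0<L Λ≤LL) (sphereRadius-lower {n} 0<L Λ≤LL) y-maximal)
      (≤-reflexive (trans (^-distrib-* C σ d′) (*-congˡ (exp-½^ LL d′))))
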